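{- Let $H$ be a bipartite graph of order $h$ with parts $A$ and $B$ such that every vertex of $B$ has degree at most $s$ in $H$, where $s\ge 2$. There is a constant $c=c(H)>0$ such that every $H$-free graph $G$ with average degree $r$ contains a minor with average degree at least $c\,r^{1+\frac{1}{2(s-1)}}$.
   Context: All graphs are finite, simple. $G$ is $H$-free if it has no subgraph isomorphic to $H$. The average degree of $G$ is $2|E(G)|/|V(G)|$. A graph $\Gamma$ is a minor of $G$ if there are vertex-disjoint connected subgraphs $G_u\subseteq G$, $u\in V(\Gamma)$, with an edge of $G$ between $G_u$ and $G_{u'}$ whenever $uu'\in E(\Gamma)$. -}

module Defs where

open import Data.Nat using (ℕ; zero; suc; _+_; _≤_; NonZero)
open import Data.Bool using (Bool; true; false; if_then_else_)
open import Data.Fin using (Fin; zero; suc)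
open import Data.Maybe using (Maybe; just; nothing)
open import Data.Product using (Σ; ∃; ∃-syntax; _×_; _,_)
open import Data.Empty using (⊥)
open import Relation.Nullary using (¬_)
open import Relation.Binary.PropositionalEquality using (_≡_; _≢_)
open import Data.Integer using (+_)
open import Data.Rational using (ℚ; _/_; 1ℚ; _*_)
open import Function.Definitions using (Injective)

record Graph : Set where
  field
    order : ℕ
    adj   : Fin order → Fin order → Bool
    sym   : ∀ u v → adj u v ≡ adj v u
    irrefl : ∀ u → adj u u ≡ false
open Graph public

Adj : (G : Graph) → Fin (order G) → Fin (order G) → Set
Adj G u v = adj G u v ≡ true

count : (n : ℕ) → (Fin n → Bool) → ℕ
count zero    p = 0
count (suc n) p = (if p zero then 1 else 0) + count n (λ i → p (suc i))

sumFin : (n : ℕ) → (Fin n → ℕ) → ℕ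
sumFin zero    f = 0
sumFin (suc n) f = f zero + sumFin n (λ i → f (suc i))

degree : (G : Graph) → Fin (order G) → ℕ
degree G u = count (order G) (adj G u)

degSum : Graph → ℕ
degSum G = sumFin (order G) (degree G)

avgDeg : (G : Graph) → .{{NonZero (order G)}} → ℚ
avgDeg G = (+ degSum G) / order G

_^ℚ_ : ℚ → ℕ → ℚ
q ^ℚ zero  = 1ℚ
q ^ℚ suc k = q * (q ^ℚ k)

SubgraphOf : Graph → Graph → Set
SubgraphOf H G =
  Σ (Fin (order H) → Fin (order G)) λ f →
    Injective _≡_ _≡_ f × (∀ u v → Adj H u v → Adj G (f u) (f v))

HFree : Graph → Graph → Set
HFree H G = ¬ SubgraphOf H G

-- H is bipartite with parts A (side = false) and B (side = true):
-- every edge joins the two parts, and every vertex of B has degree at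
-- most s in H.
BipartiteBDeg≤ : Graph → ℕ → Set
BipartiteBDeg≤ H s =
  Σ (Fin (order H) → Bool) λ side →
    (∀ u v → Adj H u v → side u ≢ side v) ×
    (∀ v → side v ≡ true → degree H v ≤ s)

data WalkIn (G : Graph) (S : Fin (order G) → Set) : Fin (order G) → Fin (order G) → Set where
  here : ∀ {x} → S x → WalkIn G S x x
  step : ∀ {x y z} → S x → Adj G x y → WalkIn G S y z → WalkIn G S x z

-- Γ is a minor of G: vertex-disjoint branch sets G_u (u ∈ V(Γ)), given by
-- φ : V(G) → Maybe V(Γ) (G_u = φ⁻¹(just u)), each nonempty and connected,
-- with an edge of G between G_u and G_u' whenever uu' ∈ E(Γ).
MinorOf : Graph → Graph → Set
MinorOf Γ G =
  Σ (Fin (order G) → Maybe (Fin (order Γ))) λ φ →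
    (∀ u → ∃[ x ] φ x ≡ just u) ×
    (∀ u x y → φ x ≡ just u → φ y ≡ just u → WalkIn G (λ z → φ z ≡ just u) x y) ×
    (∀ u u′ → Adj Γ u u′ → ∃[ x ] ∃[ y ] (φ x ≡ just u × φ y ≡ just u′ × Adj G x y))

{-# OPTIONS --safe #-}

-- Write s = s′ + 1, h = |H|, t = h + s, Q = q^(2s′), and suppose the average degree r of G is at least a
-- large constant times Q.  Split V(G) into X and Y with |Y| ≤ |X| and at least half of the edges between
-- them, and greedily pack disjoint stars with q leaves in X and centre in Y; let Z be the set of centres.
-- Then q|Z| ≤ |X|, and every y ∈ Y ∖ Z has at most q unpacked neighbours in X, so there are ≫ Q|X| edges
-- either between X and Z or between the packed part of X and Y ∖ Z.
--
-- In both cases there are |Z| disjoint connected sets (single centres, or stars) and a set T of further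
-- vertices.  Each i ∈ T in turn is merged into one of the sets it sees if this creates new adjacencies with
-- a fixed fraction of the sets it sees.  If the resulting graph E on Z has average degree below q Q, then
-- most i are not merged, and the sets seen by such an i form an almost complete subgraph of E.
-- Call an s-tuple poor if it has fewer than h common neighbours in T.  A t-tuple of distinct vertices
-- without poor s-subtuples would allow H to be embedded greedily; hence a positive fraction of the
-- s-cliques of E seen by i come from poor tuples.  Counting pairs (poor tuple, common neighbour) bounds
-- these by h q^s · #(s-cliques of E), and a graph all of whose subgraphs have minimum degree below q Q has
-- at most s (q Q)^s′ |Z| ordered s-cliques.  Since q^(2s′) = Q, this is too few.
-- So G has a minor of average degree at least q Q, which is of order r^(1 + 1/(2s′)) for maximal q.

module Submission where

open import Defs renaming (sym to adj-sym)
open import Data.Nat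
open import Data.Nat.Properties
open import Data.Nat.Tactic.RingSolver using (solve-∀)
open import Data.Bool as Bool using (Bool; true; false; if_then_else_; _∧_; _∨_; not)
open import Data.Fin using (Fin; zero; suc; _↑ˡ_; inject≤)
import Data.Fin.Properties as Fin
open import Data.Maybe as Maybe using (Maybe; just; nothing; is-just)
open import Data.Product
open import Data.Sum using (_⊎_; inj₁; inj₂)
open import Data.Empty using (⊥; ⊥-elim)
open import Data.Unit using (⊤; tt)
open import Data.Vec as Vec using (Vec; []; _∷_; lookup; tabulate; replicate)
open import Data.Vec.Relation.Unary.All as All using (All; []; _∷_)
open import Data.Vec.Relation.Unary.All.Properties using (lookup⁺)
open import Data.Vec.Relation.Binary.Pointwise.Inductive using (Pointwise; []; _∷_)
open import Data.Vec.Properties using (lookup-map; lookup∘tabulate)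
open import Data.Bool.Properties using (∧-zeroʳ; ∨-comm; not-involutive)
open import Data.Maybe.Properties using (just-injective)
open import Relation.Nullary
open import Relation.Nullary.Decidable using (_×-dec_)
open import Relation.Binary.PropositionalEquality hiding ([_])
open import Function using (_∘_; case_of_)
import Data.Integer as ℤ
import Data.Integer.Properties as ℤ
open import Data.Rational as ℚ using (ℚ; 0ℚ; 1ℚ; fromℚᵘ; toℚᵘ; NonNegative) renaming (_<_ to _<ℚ_; _≤_ to _≤ℚ_; _*_ to _*ℚ_)
import Data.Rational.Properties as ℚ
open import Data.Rational.Unnormalised as ℚᵘ using (mkℚᵘ; *≤*; *≡*)
import Data.Rational.Unnormalised.Properties as ℚᵘ

-- Booleans and indicator values

infix 7 _==_

𝟙 : Bool → ℕ
𝟙 true  = 1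
𝟙 false = 0

∧-elim : ∀ {a b} → a ∧ b ≡ true → a ≡ true × b ≡ true
∧-elim {true} {true} _ = refl , refl

∧-intro : ∀ {a b} → a ≡ true → b ≡ true → a ∧ b ≡ true
∧-intro refl refl = refl

∨-elim : ∀ {a b} → a ∨ b ≡ true → a ≡ true ⊎ b ≡ true
∨-elim {true}  _ = inj₁ refl
∨-elim {false} p = inj₂ p

∨-introˡ : ∀ {a} b → a ≡ true → a ∨ b ≡ true
∨-introˡ _ refl = refl

∨-introʳ : ∀ a {b} → b ≡ true → a ∨ b ≡ true
∨-introʳ true  refl = refl
∨-introʳ false refl = refl

not-true : ∀ {a} → not a ≡ true → a ≡ false
not-true {false} _ = refl

true≢false : ∀ {a} → a ≡ true → a ≡ false → ⊥
true≢false refl ()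

≢true⇒false : ∀ {a} → ¬ (a ≡ true) → a ≡ false
≢true⇒false {false} _ = refl
≢true⇒false {true} ¬p = ⊥-elim (¬p refl)

_==_ : ∀ {n} → Fin n → Fin n → Bool
i == j = does (i Fin.≟ j)

==-sound : ∀ {n} {i j : Fin n} → i == j ≡ true → i ≡ j
==-sound {i = i} {j} p with i Fin.≟ j
... | yes e = e

==-refl : ∀ {n} (i : Fin n) → i == i ≡ true
==-refl i with i Fin.≟ i
... | yes _ = refl
... | no ne = ⊥-elim (ne refl)

≢⇒==-false : ∀ {n} {i j : Fin n} → i ≢ j → i == j ≡ false
≢⇒==-false ne = ≢true⇒false (λ e → ne (==-sound e))

𝟙-mono : ∀ {a b} → (a ≡ true → b ≡ true) → 𝟙 a ≤ 𝟙 b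
𝟙-mono {false} _ = z≤n
𝟙-mono {true} f rewrite f refl = ≤-refl

𝟙-true : ∀ {a} → a ≡ true → 1 ≤ 𝟙 a
𝟙-true refl = ≤-refl

𝟙-≤ : ∀ a {c} → (a ≡ true → 1 ≤ c) → 𝟙 a ≤ c
𝟙-≤ true  f = f refl
𝟙-≤ false f = z≤n

𝟙*-≤ : ∀ a {b c} → (a ≡ true → b ≤ c) → 𝟙 a * b ≤ c
𝟙*-≤ true {b} f = subst (_≤ _) (sym (+-identityʳ b)) (f refl)
𝟙*-≤ false f = z≤n

𝟙*-mono : ∀ {a a' b c} → (a ≡ true → a' ≡ true) → (a ≡ true → b ≤ c) → 𝟙 a * b ≤ 𝟙 a' * c
𝟙*-mono {false} f g = z≤n
𝟙*-mono {true} f g rewrite f refl = +-monoˡ-≤ 0 (g refl)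

≤-𝟙* : ∀ {a b c} → a ≡ true → b ≤ c → b ≤ 𝟙 a * c
≤-𝟙* {c = c} refl p = subst (_ ≤_) (sym (+-identityʳ c)) p

-- Finite sums and cardinalities

Σ-cong : ∀ n {f g : Fin n → ℕ} → (∀ i → f i ≡ g i) → sumFin n f ≡ sumFin n g
Σ-cong zero    e = refl
Σ-cong (suc n) e = cong₂ _+_ (e zero) (Σ-cong n (e ∘ suc))

Σ-mono : ∀ n {f g : Fin n → ℕ} → (∀ i → f i ≤ g i) → sumFin n f ≤ sumFin n g
Σ-mono zero    e = z≤n
Σ-mono (suc n) e = +-mono-≤ (e zero) (Σ-mono n (e ∘ suc))

Σ-+ : ∀ n (f g : Fin n → ℕ) → sumFin n (λ i → f i + g i) ≡ sumFin n f + sumFin n g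
Σ-+ zero    f g = refl
Σ-+ (suc n) f g rewrite Σ-+ n (f ∘ suc) (g ∘ suc) = lem (f zero) (g zero) _ _
  where lem : ∀ a b c d → a + b + (c + d) ≡ a + c + (b + d)
        lem = solve-∀

Σ-*ˡ : ∀ n c (f : Fin n → ℕ) → sumFin n (λ i → c * f i) ≡ c * sumFin n f
Σ-*ˡ zero    c f = sym (*-zeroʳ c)
Σ-*ˡ (suc n) c f rewrite Σ-*ˡ n c (f ∘ suc) = sym (*-distribˡ-+ c (f zero) _)

Σ-*ʳ : ∀ n (f : Fin n → ℕ) c → sumFin n (λ i → f i * c) ≡ sumFin n f * c
Σ-*ʳ zero    f c = refl
Σ-*ʳ (suc n) f c rewrite Σ-*ʳ n (f ∘ suc) c = sym (*-distribʳ-+ c (f zero) _)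

Σ-zero : ∀ n → sumFin n (λ _ → 0) ≡ 0
Σ-zero zero    = refl
Σ-zero (suc n) = Σ-zero n

Σ-one : ∀ n → sumFin n (λ _ → 1) ≡ n
Σ-one zero    = refl
Σ-one (suc n) = cong suc (Σ-one n)

Σ-swap : ∀ m n (f : Fin m → Fin n → ℕ) →
  sumFin m (λ i → sumFin n (f i)) ≡ sumFin n (λ j → sumFin m (λ i → f i j))
Σ-swap zero    n f = sym (Σ-zero n)
Σ-swap (suc m) n f rewrite Σ-swap m n (f ∘ suc) = sym (Σ-+ n (f zero) _)

Σ-term : ∀ n (f : Fin n → ℕ) i → f i ≤ sumFin n f
Σ-term (suc n) f zero    = m≤m+n _ _
Σ-term (suc n) f (suc i) = ≤-trans (Σ-term n (f ∘ suc) i) (m≤n+m _ _)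

Σ-pos : ∀ n (f : Fin n → ℕ) → 1 ≤ sumFin n f → ∃ λ i → 1 ≤ f i
Σ-pos (suc n) f p with f zero in eq
... | suc k = zero , subst (1 ≤_) (sym eq) (s≤s z≤n)
... | zero  = map suc (λ x → x) (Σ-pos n (f ∘ suc) p)

card : ∀ {n} → (Fin n → Bool) → ℕ
card {n} p = sumFin n (λ i → 𝟙 (p i))

count≡card : ∀ n p → count n p ≡ card p
count≡card zero    p = refl
count≡card (suc n) p with p zero
... | true  = cong suc (count≡card n (p ∘ suc))
... | false = count≡card n (p ∘ suc)

card-mono : ∀ {n} {p p' : Fin n → Bool} → (∀ i → p i ≡ true → p' i ≡ true) → card p ≤ card p'
card-mono {n} f = Σ-mono n (λ i → 𝟙-mono (f i))

card-pos : ∀ {n} {p : Fin n → Bool} i → p i ≡ true → 1 ≤ card p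
card-pos {n} {p} i e = ≤-trans (𝟙-true e) (Σ-term n (λ j → 𝟙 (p j)) i)

card-inhab : ∀ {n} (p : Fin n → Bool) → 1 ≤ card p → ∃ λ i → p i ≡ true
card-inhab {n} p pos with Σ-pos n _ pos
... | i , q with p i in eq
...   | true = i , eq

card-single : ∀ {n} (i : Fin n) → card (_== i) ≡ 1
card-single {suc n} zero = cong suc (trans (Σ-cong n (λ _ → refl)) (Σ-zero n))
card-single {suc n} (suc i) = trans (Σ-cong n lem) (card-single i)
  where
  lem : ∀ j → 𝟙 (suc j == suc i) ≡ 𝟙 (j == i)
  lem j with j Fin.≟ i
  ... | yes _ = refl
  ... | no  _ = refl

Σ-single : ∀ n (i : Fin n) c → sumFin n (λ j → 𝟙 (j == i) * c) ≡ c
Σ-single n i c = trans (Σ-*ʳ n _ c) (trans (cong (_* c) (card-single i)) (+-identityʳ c))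

remove : ∀ {n} → (Fin n → Bool) → Fin n → Fin n → Bool
remove p v w = p w ∧ not (w == v)

remove-intro : ∀ {n} {p : Fin n → Bool} {v w} → p w ≡ true → w ≢ v → remove p v w ≡ true
remove-intro {p = p} {v} {w} e ne rewrite e | ≢⇒==-false ne = refl

remove-≢ : ∀ {n} {p : Fin n → Bool} {v w} → remove p v w ≡ true → w ≢ v
remove-≢ {p = p} {v} {w} r refl = true≢false (==-refl w) (not-true (proj₂ (∧-elim {p w} r)))

card-remove : ∀ {n} (p : Fin n → Bool) v → card p ≤ suc (card (remove p v))
card-remove {n} p v = begin
  card p ≤⟨ Σ-mono n term ⟩
  sumFin n (λ w → 𝟙 (w == v) + 𝟙 (remove p v w)) ≡⟨ Σ-+ n _ _ ⟩
  card (_== v) + card (remove p v) ≡⟨ cong (_+ card (remove p v)) (card-single v) ⟩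
  suc (card (remove p v)) ∎
  where
  open ≤-Reasoning
  term : ∀ w → 𝟙 (p w) ≤ 𝟙 (w == v) + 𝟙 (remove p v w)
  term w with p w | w == v
  ... | false | _ = z≤n
  ... | true | true = s≤s z≤n
  ... | true | false = s≤s z≤n

card-remove-in : ∀ {n} (p : Fin n → Bool) v → p v ≡ true → card p ≡ suc (card (remove p v))
card-remove-in {n} p v pv = trans (Σ-cong n term) (trans (Σ-+ n _ _) (cong (_+ card (remove p v)) (card-single v)))
  where
  term : ∀ w → 𝟙 (p w) ≡ 𝟙 (w == v) + 𝟙 (remove p v w)
  term w with w Fin.≟ v
  ... | yes refl rewrite pv = refl
  ... | no _ with p w
  ...   | true = refl
  ...   | false = refl

subset-of-card : ∀ {n} (p : Fin n → Bool) k → k ≤ card p →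
  ∃ λ p' → (∀ i → p' i ≡ true → p i ≡ true) × card p' ≡ k
subset-of-card {zero} p zero _ = p , (λ _ x → x) , refl
subset-of-card {suc n} p zero _ = (λ _ → false) , (λ _ ()) , Σ-zero n
subset-of-card {suc n} p (suc k) le with p zero in eq
... | true with subset-of-card (p ∘ suc) k (≤-pred le)
...   | p' , sub , c = (λ { zero → true ; (suc i) → p' i }) , (λ { zero _ → eq ; (suc i) → sub i }) , cong suc c
subset-of-card {suc n} p (suc k) le | false with subset-of-card (p ∘ suc) (suc k) le
... | p' , sub , c = (λ { zero → false ; (suc i) → p' i }) , (λ { zero () ; (suc i) → sub i }) , c

-- Cliques in degenerate graphs

_⊆ᵇ_ : ∀ {n} → (Fin n → Bool) → (Fin n → Bool) → Set
U ⊆ᵇ W = ∀ v → U v ≡ true → W v ≡ true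

-- cliqueSum E k U f is the sum of f over the ordered k-tuples of pairwise E-adjacent elements of U.
cliqueSum : ∀ {n} → (Fin n → Fin n → Bool) → (k : ℕ) → (Fin n → Bool) → (Vec (Fin n) k → ℕ) → ℕ
cliqueSum     E zero    U f = f []
cliqueSum {n} E (suc k) U f =
  sumFin n (λ w → 𝟙 (U w) * cliqueSum E k (λ v → U v ∧ E w v) (λ z → f (w ∷ z)))

InClique : ∀ {n} → (Fin n → Fin n → Bool) → ∀ {k} → (Fin n → Bool) → Vec (Fin n) k → Set
InClique E U []      = ⊤
InClique E U (w ∷ z) = U w ≡ true × InClique E (λ v → U v ∧ E w v) z

module _ {n : ℕ} (E : Fin n → Fin n → Bool) where

  cliqueSum-mono : ∀ k {U W} {f g : Vec (Fin n) k → ℕ} → U ⊆ᵇ W →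
    (∀ z → InClique E U z → f z ≤ g z) → cliqueSum E k U f ≤ cliqueSum E k W g
  cliqueSum-mono zero    sub le = le [] tt
  cliqueSum-mono (suc k) {U} {W} {f} {g} sub le = Σ-mono n λ w →
    𝟙*-mono (sub w) λ Uw → cliqueSum-mono k
      (λ v e → ∧-intro (sub v (proj₁ (∧-elim {U v} e))) (proj₂ (∧-elim {U v} e)))
      (λ z c → le (w ∷ z) (Uw , c))

  cliqueSum-+ : ∀ k U (f g : Vec (Fin n) k → ℕ) →
    cliqueSum E k U (λ z → f z + g z) ≡ cliqueSum E k U f + cliqueSum E k U g
  cliqueSum-+ zero    U f g = refl
  cliqueSum-+ (suc k) U f g = trans
    (Σ-cong n λ w → trans (cong (𝟙 (U w) *_) (cliqueSum-+ k _ _ _)) (*-distribˡ-+ (𝟙 (U w)) _ _))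
    (Σ-+ n _ _)

  Σ-cliqueSum : ∀ m k U (f : Fin m → Vec (Fin n) k → ℕ) →
    sumFin m (λ i → cliqueSum E k U (f i)) ≡ cliqueSum E k U (λ z → sumFin m (λ i → f i z))
  Σ-cliqueSum m zero    U f = refl
  Σ-cliqueSum m (suc k) U f = trans (Σ-swap m n _)
    (Σ-cong n λ w → trans (Σ-*ˡ m (𝟙 (U w)) _) (cong (𝟙 (U w) *_) (Σ-cliqueSum m k _ _)))

  cliqueSum-const : ∀ k U c → cliqueSum E k U (λ _ → c) ≤ card U ^ k * c
  cliqueSum-const zero    U c = ≤-reflexive (sym (+-identityʳ c))
  cliqueSum-const (suc k) U c = begin
    sumFin n (λ w → 𝟙 (U w) * cliqueSum E k (λ v → U v ∧ E w v) (λ _ → c))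
      ≤⟨ Σ-mono n (λ w → *-monoʳ-≤ (𝟙 (U w)) (cliqueSum-mono k (λ v e → proj₁ (∧-elim {U v} e)) (λ _ _ → ≤-refl))) ⟩
    sumFin n (λ w → 𝟙 (U w) * cliqueSum E k U (λ _ → c)) ≡⟨ Σ-*ʳ n _ _ ⟩
    card U * cliqueSum E k U (λ _ → c) ≤⟨ *-monoʳ-≤ (card U) (cliqueSum-const k U c) ⟩
    card U * (card U ^ k * c) ≡⟨ sym (*-assoc (card U) _ c) ⟩
    card U ^ suc k * c ∎
    where open ≤-Reasoning

  cliqueSum-*ʳ : ∀ k U (f : Vec (Fin n) k → ℕ) c → cliqueSum E k U (λ z → f z * c) ≡ cliqueSum E k U f * c
  cliqueSum-*ʳ zero    U f c = refl
  cliqueSum-*ʳ (suc k) U f c = trans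
    (Σ-cong n λ w → trans (cong (𝟙 (U w) *_) (cliqueSum-*ʳ k _ _ c)) (sym (*-assoc (𝟙 (U w)) _ c)))
    (Σ-*ʳ n _ c)

  cliques : ℕ → (Fin n → Bool) → ℕ
  cliques k U = cliqueSum E k U (λ _ → 1)

  nbrsIn : (Fin n → Bool) → Fin n → ℕ
  nbrsIn U v = card (λ w → U w ∧ E v w)

  module _ (E-sym : ∀ u v → E u v ≡ E v u) where

    -- An ordered clique through `v` has `v` in one of `k` places and all other entries among the
    -- neighbours of `v` in `U`, which leaves at most `nbrsIn U v ^ (k ∸ 1)` choices for each place.
    cliques-remove : ∀ k U v → cliques k U ≤ cliques k (remove U v) + k * nbrsIn U v ^ (k ∸ 1)
    cliques-remove zero    U v = m≤m+n 1 _
    cliques-remove (suc k) U v = begin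
      sumFin n (λ w → 𝟙 (U w) * cliques k (λ x → U x ∧ E w x)) ≤⟨ Σ-mono n term ⟩
      sumFin n (λ w → new w + (𝟙 (w == v) * d ^ k + 𝟙 (U w ∧ E v w) * (k * d ^ (k ∸ 1))))
        ≡⟨ trans (Σ-+ n new _) (cong (sumFin n new +_) (Σ-+ n _ _)) ⟩
      sumFin n new + (sumFin n (λ w → 𝟙 (w == v) * d ^ k) + sumFin n (λ w → 𝟙 (U w ∧ E v w) * (k * d ^ (k ∸ 1))))
        ≡⟨ cong (sumFin n new +_) (cong₂ _+_ (Σ-single n v _) (Σ-*ʳ n _ _)) ⟩
      sumFin n new + (d ^ k + d * (k * d ^ (k ∸ 1))) ≤⟨ +-monoʳ-≤ (sumFin n new) (+-monoʳ-≤ (d ^ k) (pow k)) ⟩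
      sumFin n new + (d ^ k + k * d ^ k) ∎
      where
      open ≤-Reasoning
      d = nbrsIn U v
      new : Fin n → ℕ
      new w = 𝟙 (remove U v w) * cliques k (λ x → remove U v x ∧ E w x)
      pow : ∀ k → d * (k * d ^ (k ∸ 1)) ≤ k * d ^ k
      -- The truncated exponent `k ∸ 1` does no harm at `k = 0`, since the factor `k` vanishes
      -- there.
      pow zero    = ≤-reflexive (*-zeroʳ d)
      pow (suc k) = ≤-reflexive (lem d (suc k) (d ^ k))
        where lem : ∀ a b c → a * (b * c) ≡ b * (a * c)
              lem = solve-∀
      term : ∀ w → 𝟙 (U w) * cliques k (λ x → U x ∧ E w x) ≤
        new w + (𝟙 (w == v) * d ^ k + 𝟙 (U w ∧ E v w) * (k * d ^ (k ∸ 1)))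
      term w with w Fin.≟ v
      ... | yes refl = 𝟙*-≤ (U w) λ Uw → ≤-trans
        (≤-trans (cliqueSum-const k _ 1) (≤-reflexive (trans (*-identityʳ (d ^ k)) (sym (+-identityʳ (d ^ k))))))
        (≤-trans (m≤m+n _ _) (m≤n+m _ (𝟙 (U w ∧ false) * _)))
      ... | no w≢v = 𝟙*-≤ (U w) go
        where
        go : U w ≡ true → cliques k (λ x → U x ∧ E w x) ≤
          𝟙 (U w ∧ true) * cliques k (λ x → remove U v x ∧ E w x) + 𝟙 (U w ∧ E v w) * (k * d ^ (k ∸ 1))
        -- If `w` is adjacent to `v`, it is one of the `d` neighbours of `v`, and the induction runs
        -- inside the neighbourhood of `w`. Otherwise that neighbourhood omits `v` and no clique is
        -- lost.
        go Uw rewrite Uw with E v w in Evw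
        ... | true = ≤-trans (cliques-remove k (λ x → U x ∧ E w x) v)
            (+-mono-≤ (≤-trans (cliqueSum-mono k rearrange (λ _ _ → ≤-refl)) (≤-reflexive (sym (+-identityʳ _))))
              (≤-trans (*-monoʳ-≤ k (^-monoˡ-≤ (k ∸ 1) (card-mono shrink))) (≤-reflexive (sym (+-identityʳ _)))))
          where
          rearrange : remove (λ x → U x ∧ E w x) v ⊆ᵇ (λ x → remove U v x ∧ E w x)
          rearrange x e = let (p , _) = ∧-elim {U x ∧ E w x} e ; (Ux , Ewx) = ∧-elim {U x} p in
            ∧-intro (remove-intro {p = U} Ux (remove-≢ {p = λ x → U x ∧ E w x} e)) Ewx
          shrink : (λ x → (U x ∧ E w x) ∧ E v x) ⊆ᵇ (λ x → U x ∧ E v x)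
          shrink x e = let (p , q) = ∧-elim {U x ∧ E w x} e in ∧-intro (proj₁ (∧-elim {U x} p)) q
        ... | false = ≤-trans (cliqueSum-mono k rearrange (λ _ _ → ≤-refl))
            (≤-trans (≤-reflexive (sym (+-identityʳ _))) (m≤m+n _ _))
          where
          rearrange : (λ x → U x ∧ E w x) ⊆ᵇ (λ x → remove U v x ∧ E w x)
          rearrange x e = let (Ux , Ewx) = ∧-elim {U x} e in
            ∧-intro (remove-intro {p = U} Ux (λ { refl → true≢false (trans (E-sym v w) Ewx) Evw })) Ewx

    -- Vertices of degree below `D` are deleted one at a time, each destroying at most
    -- `suc k * D ^ k` cliques. This stops at the empty set or at a nonempty `W` of minimum degree
    -- at least `D`; `m` bounds the number of deletions.
    cliques-degenerate : ∀ D k m U → card U ≤ m →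
      (∃ λ W → W ⊆ᵇ U × 1 ≤ card W × (∀ v → W v ≡ true → D ≤ nbrsIn W v)) ⊎
      cliques (suc k) U ≤ suc k * D ^ k * card U
    cliques-degenerate D k m U le with Fin.any? (λ v → (U v Bool.≟ true) ×-dec (nbrsIn U v <? D))
    cliques-degenerate D k zero U le | yes (v , Uv , _) = ⊥-elim (<⇒≱ (card-pos {p = U} v Uv) le)
    cliques-degenerate D k (suc m) U le | yes (v , Uv , small)
      with cliques-degenerate D k m (remove U v) (≤-pred (subst (_≤ suc m) (card-remove-in U v Uv) le))
    ... | inj₁ (W , sub , rest) = inj₁ (W , (λ x e → proj₁ (∧-elim {U x} (sub x e))) , rest)
    ... | inj₂ bound = inj₂ (begin
      cliques (suc k) U ≤⟨ cliques-remove (suc k) U v ⟩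
      cliques (suc k) (remove U v) + suc k * nbrsIn U v ^ k
        ≤⟨ +-mono-≤ bound (*-monoʳ-≤ (suc k) (^-monoˡ-≤ k (<⇒≤ small))) ⟩
      c * card (remove U v) + c ≡⟨ trans (+-comm _ c) (sym (*-suc c _)) ⟩
      c * suc (card (remove U v)) ≡⟨ cong (c *_) (sym (card-remove-in U v Uv)) ⟩
      c * card U ∎)
      where
      open ≤-Reasoning
      c = suc k * D ^ k
    cliques-degenerate D k m U le | no none with 1 ≤? card U
    ... | yes pos = inj₁ (U , (λ _ e → e) , pos , λ v Uv → ≮⇒≥ (λ lt → none (v , Uv , lt)))
    ... | no ¬pos with card U in eq
    ...   | zero = inj₂ (≤-trans (cliqueSum-const (suc k) U 1) (≤-trans (≤-reflexive (cong (λ x → x ^ suc k * 1) eq)) z≤n))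
    ...   | suc _ = ⊥-elim (¬pos (s≤s z≤n))

-- Greedy attachment

-- Counts the adjacencies that `v` would gain if a vertex seeing exactly `R` were merged into it.
new-nbrs : ∀ {n} → (Fin n → Fin n → Bool) → (Fin n → Bool) → Fin n → ℕ
new-nbrs E R v = card (λ w → R w ∧ (not (w == v) ∧ not (E v w)))

totalDegree : ∀ {n} → (Fin n → Fin n → Bool) → ℕ
totalDegree {n} E = sumFin n (λ v → card (E v))

-- `P i` is the set of centres seen by `i`. The last two fields form the dichotomy: an unmerged `i`
-- sees an almost complete set, and what the merged vertices see is charged to the edges of `E`.
record Attachment {m n} (κ : ℕ) (P : Fin m → Fin n → Bool) : Set where
  field
    E         : Fin n → Fin n → Bool
    E-sym     : ∀ u v → E u v ≡ E v u
    E-irrefl  : ∀ v → E v v ≡ false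
    attach    : Fin m → Maybe (Fin n)
    attach-∈  : ∀ i v → attach i ≡ just v → P i v ≡ true
    E-witness : ∀ v w → E v w ≡ true →
      ∃ λ i → (attach i ≡ just v × P i w ≡ true) ⊎ (attach i ≡ just w × P i v ≡ true)
    saturated : ∀ i → attach i ≡ nothing → ∀ v → P i v ≡ true → κ * new-nbrs E (P i) v ≤ card (P i)
    gain      : sumFin m (λ i → 𝟙 (is-just (attach i)) * card (P i)) ≤ κ * totalDegree E

-- A vertex is merged when this creates new adjacencies with more than a `1/κ` fraction of what it
-- sees, which gives `gain`. `saturated` survives later merges, because `new-nbrs` only decreases as
-- `E` grows.
greedy-attachment : ∀ {n} κ m (P : Fin m → Fin n → Bool) → Attachment κ P
greedy-attachment {n} κ zero P = record
  { E = λ _ _ → false ; E-sym = λ _ _ → refl ; E-irrefl = λ _ → refl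
  ; attach = λ () ; attach-∈ = λ () ; E-witness = λ _ _ () ; saturated = λ () ; gain = z≤n }
greedy-attachment {n} κ (suc m) P = extend (Fin.any? (λ v → (R v Bool.≟ true) ×-dec (card R <? κ * new-nbrs E R v)))
  where
  open Attachment (greedy-attachment κ m (P ∘ suc))
  R = P zero
  extend : Dec (∃ λ v → R v ≡ true × card R < κ * new-nbrs E R v) → Attachment κ P
  extend (no none) = record
    { E = E ; E-sym = E-sym ; E-irrefl = E-irrefl
    ; attach = λ { zero → nothing ; (suc i) → attach i }
    ; attach-∈ = λ { zero _ () ; (suc i) → attach-∈ i }
    ; E-witness = λ v w e → map suc (λ x → x) (E-witness v w e)
    ; saturated = λ { zero _ v Rv → ≮⇒≥ (λ lt → none (v , Rv , lt)) ; (suc i) → saturated i }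
    ; gain = gain }
  extend (yes (c , Rc , big)) = record
    { E = E⁺ ; E-sym = E⁺-sym ; E-irrefl = E⁺-irrefl
    ; attach = att
    ; attach-∈ = λ { zero _ refl → Rc ; (suc i) → attach-∈ i }
    ; E-witness = E⁺-witness
    ; saturated = λ { zero () ; (suc i) none v Pv → ≤-trans (*-monoʳ-≤ κ (card-mono (fewer (P (suc i)) v))) (saturated i none v Pv) }
    ; gain = gain⁺ }
    where
    spoke : Fin n → Fin n → Bool
    spoke u v = (u == c) ∧ (R v ∧ not (v == c))
    E⁺ : Fin n → Fin n → Bool
    E⁺ u v = E u v ∨ (spoke u v ∨ spoke v u)
    E⁺-sym : ∀ u v → E⁺ u v ≡ E⁺ v u
    E⁺-sym u v = cong₂ _∨_ (E-sym u v) (∨-comm (spoke u v) (spoke v u))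
    spoke-irrefl : ∀ v → spoke v v ≡ false
    spoke-irrefl v with v == c | R v
    ... | true  | true  = refl
    ... | true  | false = refl
    ... | false | _     = refl
    E⁺-irrefl : ∀ v → E⁺ v v ≡ false
    E⁺-irrefl v rewrite E-irrefl v | spoke-irrefl v = refl
    spoke-elim : ∀ u v → spoke u v ≡ true → c ≡ u × R v ≡ true
    spoke-elim u v e = let (p , r) = ∧-elim {u == c} e in sym (==-sound p) , proj₁ (∧-elim {R v} r)
    att : Fin (suc m) → Maybe (Fin n)
    att zero    = just c
    att (suc i) = attach i
    E⁺-witness : ∀ v w → E⁺ v w ≡ true →
      ∃ λ i → (att i ≡ just v × P i w ≡ true) ⊎ (att i ≡ just w × P i v ≡ true)
    E⁺-witness v w e with ∨-elim {E v w} e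
    ... | inj₁ old = map suc (λ x → x) (E-witness v w old)
    ... | inj₂ new with ∨-elim {spoke v w} new
    ...   | inj₁ sp = zero , inj₁ (let (a , b) = spoke-elim v w sp in cong just a , b)
    ...   | inj₂ sp = zero , inj₂ (let (a , b) = spoke-elim w v sp in cong just a , b)
    fewer : ∀ (S : Fin n → Bool) v w → S w ∧ (not (w == v) ∧ not (E⁺ v w)) ≡ true → S w ∧ (not (w == v) ∧ not (E v w)) ≡ true
    fewer S v w e with S w | w == v | E v w
    ... | true | false | false = refl
    ... | true | false | true  = e
    term : ∀ u v → 𝟙 (E u v) + 𝟙 (u == c) * 𝟙 (R v ∧ (not (v == c) ∧ not (E c v))) ≤ 𝟙 (E⁺ u v)
    term u v with u Fin.≟ c
    term u v | no _ rewrite +-identityʳ (𝟙 (E u v)) = 𝟙-mono {E u v} (∨-introˡ _)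
    term u v | yes refl with E u v | R v | v == u
    ... | true  | true  | true  = ≤-refl
    ... | true  | true  | false = ≤-refl
    ... | true  | false | _     = ≤-refl
    ... | false | true  | true  = z≤n
    ... | false | true  | false = ≤-refl
    ... | false | false | _     = z≤n
    -- Only the entries in row `c` are counted; the reversed spokes are given away.
    gained : totalDegree E + new-nbrs E R c ≤ totalDegree E⁺
    gained = begin
      totalDegree E + new-nbrs E R c ≡⟨ cong (totalDegree E +_) (sym (Σ-single n c _)) ⟩
      totalDegree E + sumFin n (λ u → 𝟙 (u == c) * new-nbrs E R c) ≡⟨ sym (Σ-+ n _ _) ⟩
      sumFin n (λ u → card (E u) + 𝟙 (u == c) * new-nbrs E R c)
        ≡⟨ Σ-cong n (λ u → trans (cong (card (E u) +_) (sym (Σ-*ˡ n (𝟙 (u == c)) _))) (sym (Σ-+ n _ _))) ⟩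
      sumFin n (λ u → sumFin n (λ v → 𝟙 (E u v) + 𝟙 (u == c) * 𝟙 (R v ∧ (not (v == c) ∧ not (E c v)))))
        ≤⟨ Σ-mono n (λ u → Σ-mono n (term u)) ⟩
      totalDegree E⁺ ∎
      where open ≤-Reasoning
    gain⁺ : card R + 0 + sumFin m (λ i → 𝟙 (is-just (attach i)) * card (P (suc i))) ≤ κ * totalDegree E⁺
    gain⁺ = begin
      card R + 0 + sumFin m (λ i → 𝟙 (is-just (attach i)) * card (P (suc i)))
        ≤⟨ +-mono-≤ (≤-trans (≤-reflexive (+-identityʳ _)) (<⇒≤ big)) gain ⟩
      κ * new-nbrs E R c + κ * totalDegree E ≡⟨ trans (sym (*-distribˡ-+ κ _ _)) (cong (κ *_) (+-comm _ (totalDegree E))) ⟩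
      κ * (totalDegree E + new-nbrs E R c) ≤⟨ *-monoʳ-≤ κ gained ⟩
      κ * totalDegree E⁺ ∎
      where open ≤-Reasoning

-- Subsequences of cliques

subseqSum : ∀ {A : Set} s t → (Vec A s → ℕ) → Vec A t → ℕ
subseqSum zero    t       f z       = f []
subseqSum (suc s) zero    f z       = 0
subseqSum (suc s) (suc t) f (x ∷ z) = subseqSum s t (λ y → f (x ∷ y)) z + subseqSum (suc s) t f z

subseqSum-map : ∀ {A B : Set} (g : A → B) s t (f : Vec B s → ℕ) z →
  subseqSum s t f (Vec.map g z) ≡ subseqSum s t (f ∘ Vec.map g) z
subseqSum-map g zero    t       f z       = refl
subseqSum-map g (suc s) zero    f z       = refl
subseqSum-map g (suc s) (suc t) f (x ∷ z) =
  cong₂ _+_ (subseqSum-map g s t (λ y → f (g x ∷ y)) z) (subseqSum-map g (suc s) t f z)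

module _ {n : ℕ} (E : Fin n → Fin n → Bool) where

  -- Double counting: an `s`-clique is completed to a `t`-tuple by choosing its positions, in at
  -- most `2 ^ t` ways, and the other `t - s` entries, in at most `p` ways each. The factor `p ^ s`
  -- stands on the left to avoid the subtraction. The induction asks whether the first entry is
  -- selected.
  cliqueSum-subseq : ∀ p s t U (f : Vec (Fin n) s → ℕ) → card U ≤ p →
    p ^ s * cliqueSum E t U (subseqSum s t f) ≤ 2 ^ t * p ^ t * cliqueSum E s U f
  cliqueSum-subseq p zero t U f le = begin
    1 * cliqueSum E t U (λ _ → f []) ≡⟨ +-identityʳ _ ⟩
    cliqueSum E t U (λ _ → f []) ≤⟨ cliqueSum-const E t U (f []) ⟩
    card U ^ t * f [] ≤⟨ *-monoˡ-≤ (f []) (^-monoˡ-≤ t le) ⟩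
    p ^ t * f [] ≤⟨ *-monoˡ-≤ (f []) (m≤n*m (p ^ t) (2 ^ t) {{m^n≢0 2 t}}) ⟩
    2 ^ t * p ^ t * f [] ∎
    where open ≤-Reasoning
  cliqueSum-subseq p (suc s) zero U f le = ≤-trans (≤-reflexive (*-zeroʳ (p ^ suc s))) z≤n
  cliqueSum-subseq p (suc s) (suc t) U f le = begin
    p ^ suc s * sumFin n (λ w → 𝟙 (U w) * cliqueSum E t (N w) (λ z → first w z + rest z))
      ≡⟨ sym (Σ-*ˡ n (p ^ suc s) _) ⟩
    sumFin n (λ w → p ^ suc s * (𝟙 (U w) * cliqueSum E t (N w) (λ z → first w z + rest z)))
      ≤⟨ Σ-mono n term ⟩
    sumFin n (λ w → p * b * (𝟙 (U w) * C w) + 𝟙 (U w) * (b * cliqueSum E (suc s) U f))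
      ≡⟨ trans (Σ-+ n _ _) (cong₂ _+_ (Σ-*ˡ n (p * b) _) (Σ-*ʳ n _ _)) ⟩
    p * b * cliqueSum E (suc s) U f + card U * (b * cliqueSum E (suc s) U f)
      ≤⟨ +-monoʳ-≤ (p * b * cliqueSum E (suc s) U f) (*-monoˡ-≤ _ le) ⟩
    p * b * cliqueSum E (suc s) U f + p * (b * cliqueSum E (suc s) U f)
      -- Selecting the first entry, or leaving it free with at most `p` choices, gives the same
      -- bound twice; hence the factor 2 for each entry.
      ≡⟨ lem p (2 ^ t) (p ^ t) (cliqueSum E (suc s) U f) ⟩
    2 ^ suc t * p ^ suc t * cliqueSum E (suc s) U f ∎
    where
    open ≤-Reasoning
    b = 2 ^ t * p ^ t
    N : Fin n → Fin n → Bool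
    N w v = U v ∧ E w v
    N⊆U : ∀ w → N w ⊆ᵇ U
    N⊆U w v e = proj₁ (∧-elim {U v} e)
    C : Fin n → ℕ
    C w = cliqueSum E s (N w) (λ y → f (w ∷ y))
    first : Fin n → Vec (Fin n) t → ℕ
    first w z = subseqSum s t (λ y → f (w ∷ y)) z
    rest : Vec (Fin n) t → ℕ
    rest z = subseqSum (suc s) t f z
    lem : ∀ p a c x → p * (a * c) * x + p * (a * c * x) ≡ (2 * a) * (p * c) * x
    lem = solve-∀
    lem₂ : ∀ p c u x y → (p * c) * (u * (x + y)) ≡ p * (u * (c * x)) + u * (p * c * y)
    lem₂ = solve-∀
    lem₃ : ∀ p u b x → p * (u * (b * x)) ≡ p * b * (u * x)
    lem₃ = solve-∀
    term : ∀ w → p ^ suc s * (𝟙 (U w) * cliqueSum E t (N w) (λ z → first w z + rest z)) ≤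
      p * b * (𝟙 (U w) * C w) + 𝟙 (U w) * (b * cliqueSum E (suc s) U f)
    term w = begin
      p ^ suc s * (𝟙 (U w) * cliqueSum E t (N w) (λ z → first w z + rest z))
        ≡⟨ cong (λ x → p ^ suc s * (𝟙 (U w) * x)) (cliqueSum-+ E t (N w) (first w) rest) ⟩
      p ^ suc s * (𝟙 (U w) * (cliqueSum E t (N w) (first w) + cliqueSum E t (N w) rest))
        ≡⟨ lem₂ p (p ^ s) (𝟙 (U w)) _ _ ⟩
      p * (𝟙 (U w) * (p ^ s * cliqueSum E t (N w) (first w))) + 𝟙 (U w) * (p ^ suc s * cliqueSum E t (N w) rest)
        ≤⟨ +-mono-≤
            (*-monoʳ-≤ p (*-monoʳ-≤ (𝟙 (U w)) (cliqueSum-subseq p s t (N w) _ (≤-trans (card-mono (N⊆U w)) le))))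
            (*-monoʳ-≤ (𝟙 (U w)) (≤-trans (cliqueSum-subseq p (suc s) t (N w) f (≤-trans (card-mono (N⊆U w)) le))
              (*-monoʳ-≤ b (cliqueSum-mono E (suc s) {f = f} (N⊆U w) (λ _ _ → ≤-refl))))) ⟩
      p * (𝟙 (U w) * (b * C w)) + 𝟙 (U w) * (b * cliqueSum E (suc s) U f)
        ≡⟨ cong (_+ 𝟙 (U w) * (b * cliqueSum E (suc s) U f)) (lem₃ p (𝟙 (U w)) b (C w)) ⟩
      p * b * (𝟙 (U w) * C w) + 𝟙 (U w) * (b * cliqueSum E (suc s) U f) ∎

  module _ (t : ℕ) .{{_ : NonZero t}} (R : Fin n → Bool)
    (sparse : ∀ w → R w ≡ true → 2 * t * card (λ v → R v ∧ not (E w v)) ≤ card R) where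

    -- Each chosen vertex excludes at most a `1/(2t)` fraction of `R`. With `k` choices left, `U`
    -- still holds a fraction `(t + k)/(2t)` of `R`, so at least half of `R` is available at every
    -- choice.
    many-cliques-from : ∀ k U → U ⊆ᵇ R → (t + k) * card R ≤ 2 * t * card U →
      card R ^ k ≤ 2 ^ k * cliques E k U
    many-cliques-from zero    U sub big = ≤-refl
    many-cliques-from (suc k) U sub big = begin
      p * p ^ k ≤⟨ *-monoˡ-≤ (p ^ k) half ⟩
      2 * card U * p ^ k ≡⟨ *-assoc 2 (card U) (p ^ k) ⟩
      2 * (card U * p ^ k) ≡⟨ cong (2 *_) (sym (Σ-*ʳ n _ _)) ⟩
      2 * sumFin n (λ w → 𝟙 (U w) * p ^ k) ≤⟨ *-monoʳ-≤ 2 (Σ-mono n λ w → 𝟙*-mono {U w} (λ e → e) (extend w)) ⟩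
      2 * sumFin n (λ w → 𝟙 (U w) * (2 ^ k * cliques E k (N w)))
        ≡⟨ cong (2 *_) (trans (Σ-cong n (λ w → lem (𝟙 (U w)) (2 ^ k) _)) (Σ-*ˡ n (2 ^ k) _)) ⟩
      2 * (2 ^ k * cliques E (suc k) U) ≡⟨ sym (*-assoc 2 (2 ^ k) _) ⟩
      2 ^ suc k * cliques E (suc k) U ∎
      where
      open ≤-Reasoning
      p = card R
      N : Fin n → Fin n → Bool
      N w v = U v ∧ E w v
      lem : ∀ a b c → a * (b * c) ≡ b * (a * c)
      lem = solve-∀
      lem₂ : ∀ t x → 2 * t * x ≡ t * (2 * x)
      lem₂ = solve-∀
      half : p ≤ 2 * card U
      half = *-cancelˡ-≤ t (begin
        t * p ≤⟨ *-monoˡ-≤ p (m≤m+n t (suc k)) ⟩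
        (t + suc k) * p ≤⟨ big ⟩
        2 * t * card U ≡⟨ lem₂ t (card U) ⟩
        t * (2 * card U) ∎)
      split : ∀ w v → 𝟙 (U v) ≤ 𝟙 (N w v) + 𝟙 (R v ∧ not (E w v))
      split w v with U v in Uv | E w v
      ... | false | _ = z≤n
      ... | true | true = s≤s z≤n
      ... | true | false rewrite sub v Uv = s≤s z≤n
      extend : ∀ w → U w ≡ true → p ^ k ≤ 2 ^ k * cliques E k (N w)
      extend w Uw = many-cliques-from k (N w) (λ v e → sub v (proj₁ (∧-elim {U v} e))) (+-cancelʳ-≤ p _ _ (begin
        (t + k) * p + p ≡⟨ lem₃ t k p ⟩
        (t + suc k) * p ≤⟨ big ⟩
        2 * t * card U ≤⟨ *-monoʳ-≤ (2 * t) (≤-trans (Σ-mono n (split w)) (≤-reflexive (Σ-+ n _ _))) ⟩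
        2 * t * (card (N w) + card (λ v → R v ∧ not (E w v))) ≡⟨ *-distribˡ-+ (2 * t) _ _ ⟩
        2 * t * card (N w) + 2 * t * card (λ v → R v ∧ not (E w v)) ≤⟨ +-monoʳ-≤ _ (sparse w (sub w Uw)) ⟩
        2 * t * card (N w) + p ∎))
        where
        lem₃ : ∀ t k p → (t + k) * p + p ≡ (t + suc k) * p
        lem₃ t k p = trans (+-comm _ p) (cong (_* p) (sym (+-suc t k)))

    many-cliques : card R ^ t ≤ 2 ^ t * cliques E t R
    many-cliques = many-cliques-from t R (λ _ e → e) (≤-reflexive (cong (λ x → (t + x) * card R) (sym (+-identityʳ t))))

-- Poor tuples in H-free graphs

-- An increasing choice of positions, kept as data so that single terms of `subseqSum` can be named.
data Selection : ℕ → ℕ → Set where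
  done : Selection 0 0
  keep : ∀ {s t} → Selection s t → Selection (suc s) (suc t)
  skip : ∀ {s t} → Selection s t → Selection s (suc t)

select : ∀ {A : Set} {s t} → Selection s t → Vec A t → Vec A s
select done     []      = []
select (keep g) (x ∷ z) = x ∷ select g z
select (skip g) (x ∷ z) = select g z

select-≤-subseqSum : ∀ {A : Set} {s t} (g : Selection s t) (f : Vec A s → ℕ) z →
  f (select g z) ≤ subseqSum s t f z
select-≤-subseqSum done f [] = ≤-refl
select-≤-subseqSum (keep g) f (x ∷ z) =
  ≤-trans (select-≤-subseqSum g (λ y → f (x ∷ y)) z) (m≤m+n _ _)
select-≤-subseqSum {s = zero} (skip g) f (x ∷ z) = select-≤-subseqSum g f z
select-≤-subseqSum {s = suc s} (skip g) f (x ∷ z) = ≤-trans (select-≤-subseqSum g f z) (m≤n+m _ _)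

subseqSum-pos : ∀ {A : Set} s t (f : Vec A s → ℕ) z → 1 ≤ subseqSum s t f z →
  ∃ λ y → 1 ≤ f y × (∀ (Q : A → Set) → All Q z → All Q y)
subseqSum-pos zero t f z pos = [] , pos , λ _ _ → []
subseqSum-pos (suc s) (suc t) f (x ∷ z) pos with 1 ≤? subseqSum s t (λ y → f (x ∷ y)) z
... | yes pos₁ with subseqSum-pos s t (λ y → f (x ∷ y)) z pos₁
...   | y , fy , sub = x ∷ y , fy , λ { Q (q ∷ qs) → q ∷ sub Q qs }
subseqSum-pos (suc s) (suc t) f (x ∷ z) pos | no ¬pos₁
  with subseqSum-pos (suc s) t f z (subst (λ a → 1 ≤ a + subseqSum (suc s) t f z) (n<1⇒n≡0 (≰⇒> ¬pos₁)) pos)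
... | y , fy , sub = y , fy , λ { Q (q ∷ qs) → sub Q qs }

card-≤ : ∀ {n} (p : Fin n → Bool) → card p ≤ n
card-≤ {n} p = ≤-trans (Σ-mono n (λ i → 𝟙-≤ (p i) (λ _ → ≤-refl))) (≤-reflexive (Σ-one n))

-- Unmarked positions are skipped while enough positions remain to fill all `s` slots, and are kept
-- as filler after that. Quantifying over `Q` lets adjacency to the selected tuple pass to the
-- marked entries.
covering-selection : ∀ (A : Set) s t (p : Fin t → Bool) → card p ≤ s → s ≤ t →
  Σ (Selection s t) λ g → ∀ (Q : A → Set) z → All Q (select g z) → ∀ i → p i ≡ true → Q (lookup z i)
covering-selection A zero zero p _ _ = done , λ _ _ _ ()
covering-selection A s (suc t) p small s≤t with p zero in eq
covering-selection A (suc s) (suc t) p small s≤t | true =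
  let (g , cov) = covering-selection A s t (p ∘ suc) (≤-pred small) (≤-pred s≤t) in
  keep g , λ { Q (x ∷ z) (q ∷ qs) zero _ → q ; Q (x ∷ z) (q ∷ qs) (suc i) → cov Q z qs i }
... | false with s ≤? t
...   | yes s≤t′ =
  let (g , cov) = covering-selection A s t (p ∘ suc) small s≤t′ in
  skip g , λ { Q (x ∷ z) qs zero e → ⊥-elim (true≢false e eq) ; Q (x ∷ z) qs (suc i) → cov Q z qs i }
covering-selection A zero (suc t) p small s≤t | false | no s≰t = ⊥-elim (s≰t z≤n)
covering-selection A (suc s) (suc t) p small s≤t | false | no s≰t =
  let (g , cov) = covering-selection A s t (p ∘ suc) (≤-trans (card-≤ (p ∘ suc)) (≤-pred (≰⇒> s≰t))) (≤-pred s≤t) in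
  keep g , λ { Q (x ∷ z) (q ∷ qs) zero e → q ; Q (x ∷ z) (q ∷ qs) (suc i) → cov Q z qs i }

-- The first `h` positions of a tuple stand for the vertices of `H`. The last `s` are filler, so
-- that an `s`-subtuple can always be completed, even if `h < s`.
padFalse : ∀ {h} s → (Fin h → Bool) → Fin (h + s) → Bool
padFalse {zero}  s p i       = false
padFalse {suc h} s p zero    = p zero
padFalse {suc h} s p (suc i) = padFalse s (p ∘ suc) i

card-padFalse : ∀ {h} s (p : Fin h → Bool) → card (padFalse s p) ≡ card p
card-padFalse {zero}  s p = Σ-zero s
card-padFalse {suc h} s p = cong (𝟙 (p zero) +_) (card-padFalse s (p ∘ suc))

padFalse-↑ˡ : ∀ {h} s (p : Fin h → Bool) i → padFalse s p (i ↑ˡ s) ≡ p i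
padFalse-↑ˡ {suc h} s p zero    = refl
padFalse-↑ˡ {suc h} s p (suc i) = padFalse-↑ˡ s (p ∘ suc) i

-- Greedy choice: using up a vertex costs every later candidate set at most one element.
distinct-representatives : ∀ {n} k (C : Fin k → Fin n → Bool) → (∀ u → k ≤ card (C u)) →
  ∃ λ (f : Fin k → Fin n) → (∀ u v → f u ≡ f v → u ≡ v) × (∀ u → C u (f u) ≡ true)
distinct-representatives zero C big = (λ ()) , (λ ()) , (λ ())
distinct-representatives {n} (suc k) C big = f⁺ , inj⁺ , in⁺
  where
  first = card-inhab (C zero) (≤-trans (s≤s z≤n) (big zero))
  x = proj₁ first
  tail = distinct-representatives k (λ u → remove (C (suc u)) x)
    (λ u → ≤-pred (≤-trans (big (suc u)) (card-remove (C (suc u)) x)))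
  f = proj₁ tail
  f⁺ : Fin (suc k) → Fin n
  f⁺ zero    = x
  f⁺ (suc u) = f u
  f≢x : ∀ u → f u ≢ x
  f≢x u = remove-≢ {p = C (suc u)} (proj₂ (proj₂ tail) u)
  inj⁺ : ∀ u v → f⁺ u ≡ f⁺ v → u ≡ v
  inj⁺ zero    zero    e = refl
  inj⁺ zero    (suc v) e = ⊥-elim (f≢x v (sym e))
  inj⁺ (suc u) zero    e = ⊥-elim (f≢x u e)
  inj⁺ (suc u) (suc v) e = cong suc (proj₁ (proj₂ tail) u v e)
  in⁺ : ∀ u → C u (f⁺ u) ≡ true
  in⁺ zero    = proj₂ first
  in⁺ (suc u) = proj₁ (∧-elim {C (suc u) (f u)} (proj₂ (proj₂ tail) u))

adjAll : ∀ {n k} → (Fin n → Fin n → Bool) → Fin n → Vec (Fin n) k → Bool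
adjAll A i []      = true
adjAll A i (x ∷ z) = A i x ∧ adjAll A i z

adjAll-elim : ∀ {n k} (A : Fin n → Fin n → Bool) i (z : Vec (Fin n) k) → adjAll A i z ≡ true → All (λ x → A i x ≡ true) z
adjAll-elim A i []      e = []
adjAll-elim A i (x ∷ z) e = let (a , b) = ∧-elim {A i x} e in a ∷ adjAll-elim A i z b

adjAll-intro : ∀ {n k} (A : Fin n → Fin n → Bool) i (z : Vec (Fin n) k) → All (λ x → A i x ≡ true) z → adjAll A i z ≡ true
adjAll-intro A i []      []       = refl
adjAll-intro A i (x ∷ z) (a ∷ as) = ∧-intro a (adjAll-intro A i z as)

module _ {n : ℕ} (A : Fin n → Fin n → Bool) (T : Fin n → Bool) (h : ℕ) where

  common : ∀ {k} → Vec (Fin n) k → Fin n → Bool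
  common z i = T i ∧ adjAll A i z

  -- Numerical rather than Boolean, so that sums over tuples count the poor ones directly.
  poor : ∀ {k} → Vec (Fin n) k → ℕ
  poor z = 𝟙 (card (common z) <ᵇ h)

  poor-zero : ∀ {k} (z : Vec (Fin n) k) → poor z ≡ 0 → h ≤ card (common z)
  poor-zero z e with card (common z) <ᵇ h in eq
  ... | false = ≮⇒≥ (λ lt → subst Bool.T eq (<⇒<ᵇ lt))

  poor-count : ∀ {k} (z : Vec (Fin n) k) → poor z * card (common z) ≤ h
  poor-count z with card (common z) <ᵇ h in eq
  ... | true  = ≤-trans (≤-reflexive (+-identityʳ _)) (<⇒≤ (<ᵇ⇒< _ h (subst Bool.T (sym eq) tt)))
  ... | false = z≤n

Distinct : ∀ {A : Set} {k} → Vec A k → Set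
Distinct z = ∀ i j → lookup z i ≡ lookup z j → i ≡ j

module _ (G H : Graph) (s : ℕ) (bip : BipartiteBDeg≤ H s) (free : HFree H G) where

  private
    h = order H
    side = proj₁ bip

  module Embedding (T : Fin (order G) → Bool) (z : Vec (Fin (order G)) (h + s)) (distinct : Distinct z)
    (outside : ∀ i → T (lookup z i) ≡ false)
    (rich : ∀ (g : Selection s (h + s)) → h ≤ card (common (adj G) T h (select g z))) where

    -- Empty for `v` in the part `A`, so that one system of distinct representatives can be taken
    -- over all of `V(H)`.
    nbrs : Fin h → Fin h → Bool
    nbrs v u = side v ∧ adj H v u

    nbrs-small : ∀ v → card (nbrs v) ≤ s
    nbrs-small v with side v in sv
    ... | false = ≤-trans (≤-reflexive (Σ-zero h)) z≤n
    ... | true  = subst (_≤ s) (count≡card h (adj H v)) (proj₂ (proj₂ bip) v sv)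

    sel : ∀ v → Σ (Selection s (h + s)) λ g → ∀ (Q : Fin (order G) → Set) z → All Q (select g z) →
      ∀ i → padFalse s (nbrs v) i ≡ true → Q (lookup z i)
    sel v = covering-selection (Fin (order G)) s (h + s) (padFalse s (nbrs v))
      (≤-trans (≤-reflexive (card-padFalse s (nbrs v))) (nbrs-small v)) (m≤n+m s h)

    C : Fin h → Fin (order G) → Bool
    C v = common (adj G) T h (select (proj₁ (sel v)) z)

    sdr : ∃ λ (f : Fin h → Fin (order G)) → (∀ u v → f u ≡ f v → u ≡ v) × (∀ u → C u (f u) ≡ true)
    sdr = distinct-representatives h C (λ v → rich (proj₁ (sel v)))

    g : Fin h → Fin (order G)
    g = proj₁ sdr

    g∈T : ∀ v → T (g v) ≡ true
    g∈T v = proj₁ (∧-elim {T (g v)} (proj₂ (proj₂ sdr) v))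

    g-adj : ∀ v u → side v ≡ true → Adj H v u → Adj G (g v) (lookup z (u ↑ˡ s))
    g-adj v u sv e = proj₂ (sel v) (λ x → Adj G (g v) x) z
      (adjAll-elim (adj G) (g v) _ (proj₂ (∧-elim {T (g v)} (proj₂ (proj₂ sdr) v)))) (u ↑ˡ s)
      (trans (padFalse-↑ˡ s (nbrs v) u) (∧-intro sv e))

    place : Bool → Fin h → Fin (order G)
    place b v = if b then g v else lookup z (v ↑ˡ s)

    place-injective : ∀ a b u v → place a u ≡ place b v → u ≡ v
    place-injective true  true  u v e = proj₁ (proj₂ sdr) u v e
    place-injective true  false u v e = ⊥-elim (true≢false (g∈T u) (trans (cong T e) (outside _)))
    place-injective false true  u v e = ⊥-elim (true≢false (g∈T v) (trans (cong T (sym e)) (outside _)))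
    place-injective false false u v e = Fin.↑ˡ-injective s u v (distinct _ _ e)

    place-adj : ∀ a b u v → side u ≡ a → side v ≡ b → Adj H u v → Adj G (place a u) (place b v)
    place-adj true  true  u v su sv e = ⊥-elim (proj₁ (proj₂ bip) u v e (trans su (sym sv)))
    place-adj false false u v su sv e = ⊥-elim (proj₁ (proj₂ bip) u v e (trans su (sym sv)))
    place-adj true  false u v su sv e = g-adj u v su e
    place-adj false true  u v su sv e = trans (adj-sym G _ _) (g-adj v u sv (trans (adj-sym H v u) e))

    -- The part `A` goes to the first `h` entries of `z`. A vertex of `B` goes to a common
    -- neighbour, in `T`, of an `s`-subtuple that covers the images of its neighbours. The two
    -- images are disjoint because `z` avoids `T`.
    embedding : SubgraphOf H G
    embedding = (λ v → place (side v) v) , (λ {u} {v} → place-injective (side u) (side v) u v) ,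
      λ u v → place-adj (side u) (side v) u v refl refl

  -- If the sum were zero, every `s`-subtuple would have at least `h` common neighbours in `T`, and
  -- `H` would embed.
  distinct-tuple-poor : (T : Fin (order G) → Bool) (z : Vec (Fin (order G)) (h + s)) → Distinct z →
    (∀ i → T (lookup z i) ≡ false) → 1 ≤ subseqSum s (h + s) (poor (adj G) T h) z
  distinct-tuple-poor T z distinct outside = ≮⇒≥ λ none →
    free (Embedding.embedding T z distinct outside λ g → poor-zero (adj G) T h (select g z)
      (n<1⇒n≡0 (≤-<-trans (select-≤-subseqSum g (poor (adj G) T h) z) none)))

-- Minors from branch sets

-- Renames a vertex subset as an initial segment so that it can carry a graph of its own; `Σ-elem`
-- transports the degree sums.
record Enumeration {n} (p : Fin n → Bool) : Set where
  field
    size      : ℕ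
    elem      : Fin size → Fin n
    index     : Fin n → Maybe (Fin size)
    elem-∈    : ∀ i → p (elem i) ≡ true
    index-elem : ∀ i → index (elem i) ≡ just i
    elem-index : ∀ x i → index x ≡ just i → elem i ≡ x
    Σ-elem    : ∀ f → sumFin size (f ∘ elem) ≡ sumFin n (λ x → 𝟙 (p x) * f x)

  size≡card : size ≡ card p
  size≡card = trans (sym (Σ-one size)) (trans (Σ-elem (λ _ → 1)) (Σ-cong n (λ x → *-identityʳ (𝟙 (p x)))))

enumerate : ∀ {n} (p : Fin n → Bool) → Enumeration p
enumerate {zero} p = record
  { size = 0 ; elem = λ () ; index = λ () ; elem-∈ = λ () ; index-elem = λ () ; elem-index = λ () ; Σ-elem = λ _ → refl }
enumerate {suc n} p = extend (p zero) refl
  where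
  open Enumeration (enumerate (p ∘ suc))
  extend : ∀ b → p zero ≡ b → Enumeration p
  extend false p0 = record
    { size = size ; elem = suc ∘ elem ; index = index⁺
    ; elem-∈ = elem-∈ ; index-elem = index-elem ; elem-index = elem-index⁺
    ; Σ-elem = λ f → trans (Σ-elem (f ∘ suc)) (cong (λ b → 𝟙 b * f zero + sumFin n (λ x → 𝟙 (p (suc x)) * f (suc x))) (sym p0)) }
    where
    index⁺ : Fin (suc n) → Maybe (Fin size)
    index⁺ zero    = nothing
    index⁺ (suc x) = index x
    elem-index⁺ : ∀ x i → index⁺ x ≡ just i → suc (elem i) ≡ x
    elem-index⁺ (suc x) i e = cong suc (elem-index x i e)
  extend true p0 = record
    { size = suc size ; elem = elem⁺ ; index = index⁺
    ; elem-∈ = λ { zero → p0 ; (suc i) → elem-∈ i }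
    ; index-elem = λ { zero → refl ; (suc i) → cong (Maybe.map suc) (index-elem i) }
    ; elem-index = elem-index⁺
    ; Σ-elem = λ f → cong₂ _+_ (trans (sym (+-identityʳ (f zero))) (cong (λ b → 𝟙 b * f zero) (sym p0))) (Σ-elem (f ∘ suc)) }
    where
    elem⁺ : Fin (suc size) → Fin (suc n)
    elem⁺ zero    = zero
    elem⁺ (suc i) = suc (elem i)
    index⁺ : Fin (suc n) → Maybe (Fin (suc size))
    index⁺ zero    = just zero
    index⁺ (suc x) = Maybe.map suc (index x)
    elem-index⁺ : ∀ x i → index⁺ x ≡ just i → elem⁺ i ≡ x
    elem-index⁺ zero    zero    e = refl
    elem-index⁺ (suc x) i e with index x in eq
    elem-index⁺ (suc x) (suc i) refl | just .i = cong suc (elem-index x i eq)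

-- A minor of average degree at least `D`, stated without division.
DenseMinor : Graph → ℕ → Set
DenseMinor G D = Σ Graph λ Γ → NonZero (order Γ) × MinorOf Γ G × D * order Γ ≤ degSum Γ

module _ {G : Graph} {S : Fin (order G) → Set} where

  walk-start : ∀ {x y} → WalkIn G S x y → S x
  walk-start (here p)     = p
  walk-start (step p _ _) = p

  _++ʷ_ : ∀ {x y z} → WalkIn G S x y → WalkIn G S y z → WalkIn G S x z
  here _     ++ʷ w′ = w′
  step p e w ++ʷ w′ = step p e (w ++ʷ w′)

  reverseʷ : ∀ {x y} → WalkIn G S x y → WalkIn G S y x
  reverseʷ (here p) = here p
  reverseʷ (step {x} {y} p e w) = reverseʷ w ++ʷ step (walk-start w) (trans (adj-sym G y x) e) (here p)

mapʷ : ∀ {G S S′} → (∀ {x} → S x → S′ x) → ∀ {x y} → WalkIn G S x y → WalkIn G S′ x y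
mapʷ f (here p)     = here (f p)
mapʷ f (step p e w) = step (f p) e (mapʷ f w)

module _ (G : Graph) (φ : Fin (order G) → Maybe (Fin (order G)))
  (toRoot : ∀ x w → φ x ≡ just w → WalkIn G (λ z → φ z ≡ just w) x w)
  (E : Fin (order G) → Fin (order G) → Bool) (E-sym : ∀ u v → E u v ≡ E v u) (E-irrefl : ∀ v → E v v ≡ false)
  (E-edge : ∀ v w → E v w ≡ true → ∃[ x ] ∃[ y ] (φ x ≡ just v × φ y ≡ just w × Adj G x y)) where

  -- Branch sets are named by their roots, which are vertices of `G`. Those rooted in `U` become the
  -- vertices of the minor, and every other branch set is dropped through `index`.
  dense-minor : ∀ U D → (∀ w → U w ≡ true → φ w ≡ just w) → 1 ≤ card U →
    D * card U ≤ sumFin (order G) (λ v → 𝟙 (U v) * nbrsIn E U v) → DenseMinor G D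
  dense-minor U D root inhabited dense =
    Γ , >-nonZero (subst (1 ≤_) (sym size≡card) inhabited) , (ψ , nonempty , connected , edges) , dense′
    where
    open Enumeration (enumerate U)
    Γ : Graph
    Γ = record { order = size ; adj = λ i j → E (elem i) (elem j)
               ; sym = λ i j → E-sym (elem i) (elem j) ; irrefl = λ i → E-irrefl (elem i) }
    ψ : Fin (order G) → Maybe (Fin size)
    ψ x = φ x Maybe.>>= index
    fromφ : ∀ {x} u → φ x ≡ just (elem u) → ψ x ≡ just u
    fromφ u e rewrite e = index-elem u
    toφ : ∀ x u → ψ x ≡ just u → φ x ≡ just (elem u)
    toφ x u e with φ x
    ... | just w = cong just (sym (elem-index w u e))
    nonempty : ∀ u → ∃[ x ] ψ x ≡ just u
    nonempty u = elem u , fromφ u (root (elem u) (elem-∈ u))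
    connected : ∀ u x y → ψ x ≡ just u → ψ y ≡ just u → WalkIn G (λ z → ψ z ≡ just u) x y
    -- Two vertices of a branch set are joined through its root.
    connected u x y ex ey = mapʷ (fromφ u) (toRoot x _ (toφ x u ex) ++ʷ reverseʷ (toRoot y _ (toφ y u ey)))
    edges : ∀ u u′ → Adj Γ u u′ → ∃[ x ] ∃[ y ] (ψ x ≡ just u × ψ y ≡ just u′ × Adj G x y)
    edges u u′ e = let (x , y , ex , ey , a) = E-edge (elem u) (elem u′) e in x , y , fromφ u ex , fromφ u′ ey , a
    degree≡ : ∀ i → degree Γ i ≡ nbrsIn E U (elem i)
    degree≡ i = trans (count≡card size _) (trans (Σ-elem (λ x → 𝟙 (E (elem i) x))) (Σ-cong (order G) λ x → lem (U x) (E (elem i) x)))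
      where
      lem : ∀ a b → 𝟙 a * 𝟙 b ≡ 𝟙 (a ∧ b)
      lem true  true  = refl
      lem true  false = refl
      lem false _     = refl
    dense′ : D * size ≤ degSum Γ
    dense′ = begin
      D * size ≡⟨ cong (D *_) size≡card ⟩
      D * card U ≤⟨ dense ⟩
      sumFin (order G) (λ v → 𝟙 (U v) * nbrsIn E U v) ≡⟨ sym (Σ-elem (nbrsIn E U)) ⟩
      sumFin size (λ i → nbrsIn E U (elem i)) ≡⟨ Σ-cong size (λ i → sym (degree≡ i)) ⟩
      degSum Γ ∎
      where open ≤-Reasoning

-- Incidences with poor tuples

InClique-∈ : ∀ {n} (E : Fin n → Fin n → Bool) {k} {U} (z : Vec (Fin n) k) → InClique E U z → ∀ i → U (lookup z i) ≡ true
InClique-∈ E (w ∷ z) (Uw , c) zero = Uw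
InClique-∈ E {U = U} (w ∷ z) (Uw , c) (suc i) = proj₁ (∧-elim {U (lookup z i)} (InClique-∈ E z c i))

InClique-distinct : ∀ {n} (E : Fin n → Fin n → Bool) → (∀ v → E v v ≡ false) →
  ∀ {k} {U} (z : Vec (Fin n) k) → InClique E U z → Distinct z
InClique-distinct E irr {U = U} (w ∷ z) (Uw , c) = λ
  { zero zero _ → refl
  ; zero (suc j) e → ⊥-elim (fresh j (sym e))
  ; (suc i) zero e → ⊥-elim (fresh i e)
  ; (suc i) (suc j) e → cong suc (InClique-distinct E irr z c i j e) }
  where
  fresh : ∀ i → lookup z i ≢ w
  fresh i e = true≢false (subst (λ x → E w x ≡ true) e (proj₂ (∧-elim {U (lookup z i)} (InClique-∈ E z c i)))) (irr w)

-- prodSum S (w₁ ∷ … ∷ wₖ) f is the sum of f over S w₁ × … × S wₖ.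
prodSum : ∀ {n k} → (Fin n → Fin n → Bool) → Vec (Fin n) k → (Vec (Fin n) k → ℕ) → ℕ
prodSum     S []      f = f []
prodSum {n} S (w ∷ z) f = sumFin n (λ x → 𝟙 (S w x) * prodSum S z (λ y → f (x ∷ y)))

module _ {n : ℕ} (S : Fin n → Fin n → Bool) where

  prodSum-mono : ∀ {k} (z : Vec (Fin n) k) {f g : Vec (Fin n) k → ℕ} → (∀ x → f x ≤ g x) → prodSum S z f ≤ prodSum S z g
  prodSum-mono []      le = le []
  prodSum-mono (w ∷ z) le = Σ-mono n λ x → *-monoʳ-≤ (𝟙 (S w x)) (prodSum-mono z (λ y → le (x ∷ y)))

  prodSum-term : ∀ {k} {z x : Vec (Fin n) k} (f : Vec (Fin n) k → ℕ) →
    Pointwise (λ w y → S w y ≡ true) z x → f x ≤ prodSum S z f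
  prodSum-term f [] = ≤-refl
  prodSum-term {z = w ∷ z} {x ∷ y} f (Swx ∷ pw) = ≤-trans
    (≤-𝟙* Swx (prodSum-term (λ y → f (x ∷ y)) pw)) (Σ-term n (λ x → 𝟙 (S w x) * prodSum S z (λ y → f (x ∷ y))) x)

  prodSum-const : ∀ {k} q (z : Vec (Fin n) k) c → (∀ w → card (S w) ≤ q) → prodSum S z (λ _ → c) ≤ q ^ k * c
  prodSum-const q []      c small = ≤-reflexive (sym (+-identityʳ c))
  prodSum-const {suc k} q (w ∷ z) c small = begin
    sumFin n (λ x → 𝟙 (S w x) * prodSum S z (λ _ → c)) ≡⟨ Σ-*ʳ n _ _ ⟩
    card (S w) * prodSum S z (λ _ → c) ≤⟨ *-mono-≤ (small w) (prodSum-const q z c small) ⟩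
    q * (q ^ k * c) ≡⟨ sym (*-assoc q (q ^ k) c) ⟩
    q ^ suc k * c ∎
    where open ≤-Reasoning

  Σ-prodSum : ∀ m {k} (z : Vec (Fin n) k) (f : Fin m → Vec (Fin n) k → ℕ) →
    sumFin m (λ i → prodSum S z (f i)) ≡ prodSum S z (λ x → sumFin m (λ i → f i x))
  Σ-prodSum m []      f = refl
  Σ-prodSum m (w ∷ z) f = trans (Σ-swap m n _)
    (Σ-cong n λ x → trans (Σ-*ˡ m (𝟙 (S w x)) _) (cong (𝟙 (S w x) *_) (Σ-prodSum m z _)))

Pointwise-map : ∀ {n k} {S : Fin n → Fin n → Bool} (ρ : Fin n → Fin n) (z : Vec (Fin n) k) →
  (∀ i → S (lookup z i) (ρ (lookup z i)) ≡ true) → Pointwise (λ w y → S w y ≡ true) z (Vec.map ρ z)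
Pointwise-map ρ []      f = []
Pointwise-map ρ (w ∷ z) f = f zero ∷ Pointwise-map ρ z (f ∘ suc)

All-map : ∀ {n k} {Q : Fin n → Set} (ρ : Fin n → Fin n) (z : Vec (Fin n) k) → (∀ i → Q (ρ (lookup z i))) → All Q (Vec.map ρ z)
All-map ρ []      f = []
All-map ρ (w ∷ z) f = f zero ∷ All-map ρ z (f ∘ suc)

^-distribʳ-* : ∀ k m n → (m * n) ^ k ≡ m ^ k * n ^ k
^-distribʳ-* zero    m n = refl
^-distribʳ-* (suc k) m n rewrite ^-distribʳ-* k m n = lem m n (m ^ k) (n ^ k)
  where lem : ∀ a b c d → a * b * (c * d) ≡ a * c * (b * d)
        lem = solve-∀

-- The branch set of w ∈ Z is β⁻¹(w), a star centred at w; S w ⊆ β⁻¹(w) are the vertices of it through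
-- which the vertices of T get attached.
record StarSystem (G : Graph) (q : ℕ) : Set where
  field
    T       : Fin (order G) → Bool
    Z       : Fin (order G) → Bool
    β       : Fin (order G) → Maybe (Fin (order G))
    S       : Fin (order G) → Fin (order G) → Bool
    T-free  : ∀ i → T i ≡ true → β i ≡ nothing
    Z-root  : ∀ w → Z w ≡ true → β w ≡ just w
    β-star  : ∀ x w → β x ≡ just w → x ≡ w ⊎ Adj G x w
    β-Z     : ∀ x w → β x ≡ just w → Z w ≡ true
    S-β     : ∀ w x → S w x ≡ true → β x ≡ just w
    S-small : ∀ w → card (S w) ≤ q

-- Counting poor incidences over a star system

module Counting (G H : Graph) (s′ : ℕ) (bip : BipartiteBDeg≤ H (suc s′)) (free : HFree H G) (q : ℕ) .{{_ : NonZero q}} where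

  n = order G
  A = adj G
  h = order H
  s = suc s′
  t = h + s
  -- This exponent makes `q ^ s * D ^ s′` equal to `D * Q ^ s′`, the identity behind `core-bound`.
  Q = q ^ (2 * s′)
  D = q * Q
  -- Twice the `2 * t` that `many-cliques` asks for: one half of the allowance goes to the vertex
  -- itself, which is not its own neighbour.
  κ = 4 * t
  -- Vertices seeing fewer than `π` centres are discarded. The factor `4 * t` makes the others large
  -- enough for `sparse`, and the factor `Q` gives `Q ^ s′ ≤ π ^ s′`.
  π = 4 * t * Q
  C₁ = κ + 2 ^ t * 2 ^ t * h * s

  instance
    t-nonZero : NonZero t
    t-nonZero = >-nonZero (≤-trans (s≤s z≤n) (m≤n+m s h))
    Q-nonZero : NonZero Q
    Q-nonZero = m^n≢0 q (2 * s′)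
    π-nonZero : NonZero π
    π-nonZero = m*n≢0 (4 * t) Q {{m*n≢0 4 t}}

  module _ (sys : StarSystem G q) where
    open StarSystem sys

    -- Counts the poor tuples adjacent to `i ∈ T` that have one entry in `S w` for each entry `w` of
    -- `z`.
    incidences : ∀ {k} → Vec (Fin n) k → Fin n → ℕ
    incidences z i = prodSum S z (λ x → poor A T h x * 𝟙 (common A T h x i))

    -- There are at most `q ^ k` tuples over `z`, and a poor one has fewer than `h` common
    -- neighbours in `T`.
    Σ-incidences : ∀ {k} (z : Vec (Fin n) k) → sumFin n (incidences z) ≤ q ^ k * h
    Σ-incidences {k} z = begin
      sumFin n (incidences z) ≡⟨ Σ-prodSum S n z _ ⟩
      prodSum S z (λ x → sumFin n (λ i → poor A T h x * 𝟙 (common A T h x i)))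
        ≤⟨ prodSum-mono S z (λ x → ≤-trans (≤-reflexive (Σ-*ˡ n (poor A T h x) _)) (poor-count A T h x)) ⟩
      prodSum S z (λ _ → h) ≤⟨ prodSum-const S q z h S-small ⟩
      q ^ k * h ∎
      where open ≤-Reasoning

    incidence-pos : ∀ {k} {z x : Vec (Fin n) k} i → Pointwise (λ w y → S w y ≡ true) z x →
      T i ≡ true → All (λ y → A i y ≡ true) x → poor A T h x ≤ incidences z i
    incidence-pos {x = x} i pw Ti adjs = ≤-trans
      (≤-trans (≤-reflexive (sym (*-identityʳ _)))
        (*-monoʳ-≤ (poor A T h x) (𝟙-true (∧-intro Ti (adjAll-intro A i x adjs)))))
      (prodSum-term S (λ x → poor A T h x * 𝟙 (common A T h x i)) pw)

    S∉T : ∀ w x → S w x ≡ true → T x ≡ false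
    S∉T w x e = ≢true⇒false λ Tx → case trans (sym (S-β w x e)) (T-free x Tx) of λ ()

    -- `P i w` means that `i` sees the branch set of `w`, and `ρ i w` is then the contact vertex in
    -- it.
    module _ (P : Fin n → Fin n → Bool) (ρ : Fin n → Fin n → Fin n)
      (P-T : ∀ i w → P i w ≡ true → T i ≡ true) (P-Z : ∀ i w → P i w ≡ true → Z w ≡ true)
      (P-S : ∀ i w → P i w ≡ true → S w (ρ i w) ≡ true) (P-adj : ∀ i w → P i w ≡ true → Adj G i (ρ i w)) where

      module _ (att : Attachment κ P) where
        open Attachment att

        branch : Fin n → Maybe (Fin n)
        branch x = β x Maybe.<∣> attach x

        β-branch : ∀ {x w} → β x ≡ just w → branch x ≡ just w
        β-branch e rewrite e = refl

        attach-branch : ∀ x w → attach x ≡ just w → branch x ≡ just w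
        attach-branch x w e rewrite T-free x (P-T x w (attach-∈ x w e)) = e

        branch-elim : ∀ x w → branch x ≡ just w → β x ≡ just w ⊎ attach x ≡ just w
        branch-elim x w e with β x
        ... | just _  = inj₁ e
        ... | nothing = inj₂ e

        β-toRoot : ∀ x w → β x ≡ just w → WalkIn G (λ z → branch z ≡ just w) x w
        β-toRoot x w e with β-star x w e
        ... | inj₁ refl = here (β-branch e)
        ... | inj₂ a    = step (β-branch e) a (here (β-branch (Z-root w (β-Z x w e))))

        toRoot : ∀ x w → branch x ≡ just w → WalkIn G (λ z → branch z ≡ just w) x w
        toRoot x w e with branch-elim x w e
        ... | inj₁ b = β-toRoot x w b
        ... | inj₂ a = let Pxw = attach-∈ x w a in
          step e (P-adj x w Pxw) (β-toRoot (ρ x w) w (S-β w (ρ x w) (P-S x w Pxw)))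

        E-edge : ∀ v w → E v w ≡ true → ∃[ x ] ∃[ y ] (branch x ≡ just v × branch y ≡ just w × Adj G x y)
        E-edge v w e with E-witness v w e
        ... | i , inj₁ (a , p) = i , ρ i w , attach-branch i v a , β-branch (S-β w _ (P-S i w p)) , P-adj i w p
        ... | i , inj₂ (a , p) = ρ i v , i , β-branch (S-β v _ (P-S i v p)) , attach-branch i w a ,
          trans (adj-sym G _ _) (P-adj i v p)

        E-Z : ∀ v w → E v w ≡ true → Z v ≡ true × Z w ≡ true
        E-Z v w e with E-witness v w e
        ... | i , inj₁ (a , p) = P-Z i v (attach-∈ i v a) , P-Z i w p
        ... | i , inj₂ (a , p) = P-Z i v p , P-Z i w (attach-∈ i w a)

        minor-on : ∀ U → U ⊆ᵇ Z → 1 ≤ card U → D * card U ≤ sumFin n (λ v → 𝟙 (U v) * nbrsIn E U v) → DenseMinor G D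
        minor-on U U⊆Z = dense-minor G branch toRoot E E-sym E-irrefl E-edge U D (λ w Uw → β-branch (Z-root w (U⊆Z w Uw)))

        -- Otherwise `E` on all of `Z` is already dense enough; its edges have both ends in `Z`, so
        -- no degree is lost.
        few-edges : DenseMinor G D ⊎ totalDegree E ≤ D * card Z
        few-edges with totalDegree E ≤? D * card Z
        ... | yes le = inj₂ le
        ... | no ≰ = inj₁ (minor-on Z (λ _ e → e) inhabited (≤-trans (<⇒≤ (≰⇒> ≰)) (Σ-mono n row)))
          where
          inhabited : 1 ≤ card Z
          inhabited with Σ-pos n _ (≤-trans (s≤s z≤n) (≰⇒> ≰))
          ... | v , pos = let (w , e) = card-inhab (E v) pos in card-pos {p = Z} v (proj₁ (E-Z v w e))
          row : ∀ v → card (E v) ≤ 𝟙 (Z v) * nbrsIn E Z v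
          row v with Z v in Zv
          ... | true  = ≤-trans (card-mono (λ w e → ∧-intro (proj₂ (E-Z v w e)) e)) (≤-reflexive (sym (+-identityʳ _)))
          ... | false = ≮⇒≥ (λ pos → let (w , e) = card-inhab (E v) pos in true≢false (proj₁ (E-Z v w e)) Zv)

        -- A subset of minimum degree at least `D` in `E` would itself be the vertex set of a dense
        -- minor.
        few-cliques : DenseMinor G D ⊎ cliques E s Z ≤ s * D ^ s′ * card Z
        few-cliques with cliques-degenerate E E-sym D s′ (card Z) Z ≤-refl
        ... | inj₂ le = inj₂ le
        ... | inj₁ (W , W⊆Z , inhabited , dense) = inj₁ (minor-on W W⊆Z inhabited (begin
          D * card W ≡⟨ *-comm D (card W) ⟩
          card W * D ≡⟨ sym (Σ-*ʳ n _ D) ⟩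
          sumFin n (λ v → 𝟙 (W v) * D) ≤⟨ Σ-mono n (λ v → 𝟙*-mono {W v} (λ e → e) (dense v)) ⟩
          sumFin n (λ v → 𝟙 (W v) * nbrsIn E W v) ∎))
          where open ≤-Reasoning

        module _ (i : Fin n) (sat : attach i ≡ nothing) (large : 4 * t ≤ card (P i)) where

          p = card (P i)

          -- The vertices missed by `w` are `w` itself, paid for by `large`, and those counted by
          -- `new-nbrs`, paid for by `saturated`.
          sparse : ∀ w → P i w ≡ true → 2 * t * card (λ v → P i v ∧ not (E w v)) ≤ p
          sparse w Pw = *-cancelˡ-≤ 2 (begin
            2 * (2 * t * card (λ v → P i v ∧ not (E w v))) ≤⟨ *-monoʳ-≤ 2 (*-monoʳ-≤ (2 * t) missing) ⟩
            2 * (2 * t * suc (new-nbrs E (P i) w)) ≡⟨ lem t (new-nbrs E (P i) w) ⟩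
            4 * t + 4 * t * new-nbrs E (P i) w ≤⟨ +-mono-≤ large (saturated i sat w Pw) ⟩
            p + p ≡⟨ cong (p +_) (sym (+-identityʳ p)) ⟩
            2 * p ∎)
            where
            open ≤-Reasoning
            lem : ∀ t x → 2 * (2 * t * (1 + x)) ≡ 4 * t + 4 * t * x
            lem = solve-∀
            term : ∀ v → 𝟙 (P i v ∧ not (E w v)) ≤ 𝟙 (v == w) + 𝟙 (P i v ∧ (not (v == w) ∧ not (E w v)))
            term v with P i v | v == w | E w v
            ... | false | _     | _     = z≤n
            ... | true  | _     | true  = z≤n
            ... | true  | true  | false = s≤s z≤n
            ... | true  | false | false = s≤s z≤n
            missing : card (λ v → P i v ∧ not (E w v)) ≤ suc (new-nbrs E (P i) w)
            missing = ≤-trans (Σ-mono n term) (≤-reflexive (trans (Σ-+ n _ _) (cong (_+ new-nbrs E (P i) w) (card-single w))))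

          -- The clique of centres is replaced by its contact vertices. These are distinct because
          -- `β` recovers the centre from the contact, and they avoid `T` because `β` is undefined
          -- on `T`.
          clique-poor : ∀ (z : Vec (Fin n) t) → InClique E (P i) z →
            1 ≤ subseqSum s t (poor A T h ∘ Vec.map (ρ i)) z
          clique-poor z c = subst (1 ≤_) (subseqSum-map (ρ i) s t (poor A T h) z)
            (distinct-tuple-poor G H s bip free T (Vec.map (ρ i) z) distinct outside)
            where
            ∈S : ∀ k → S (lookup z k) (ρ i (lookup z k)) ≡ true
            ∈S k = P-S i _ (InClique-∈ E z c k)
            distinct : Distinct (Vec.map (ρ i) z)
            distinct k l e = InClique-distinct E E-irrefl z c k l (just-injective
              (trans (sym (S-β _ _ (∈S k))) (trans (cong β (trans (sym (lookup-map k (ρ i) z)) (trans e (lookup-map l (ρ i) z))))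
                (S-β _ _ (∈S l)))))
            outside : ∀ k → T (lookup (Vec.map (ρ i) z) k) ≡ false
            outside k = trans (cong T (lookup-map k (ρ i) z)) (S∉T _ _ (∈S k))

          -- The set seen by `i` has at least `p ^ t / 2 ^ t` ordered `t`-cliques, each with a poor
          -- `s`-subtuple of contacts. Passing to `s`-cliques by `cliqueSum-subseq` costs another
          -- `2 ^ t`, and `p ^ t` cancels.
          saturated-incidences : p ^ s ≤ 2 ^ t * 2 ^ t * cliqueSum E s Z (λ z → incidences z i)
          saturated-incidences = *-cancelʳ-≤ (p ^ s) _ (p ^ t) {{m^n≢0 p t {{p-nonZero}}}} (begin
            p ^ s * p ^ t ≤⟨ *-monoʳ-≤ (p ^ s) (many-cliques E t (P i) sparse) ⟩
            p ^ s * (2 ^ t * cliques E t (P i))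
              ≤⟨ *-monoʳ-≤ (p ^ s) (*-monoʳ-≤ (2 ^ t) (cliqueSum-mono E t (λ _ e → e) clique-poor)) ⟩
            p ^ s * (2 ^ t * cliqueSum E t (P i) (subseqSum s t f)) ≡⟨ lem₁ (p ^ s) (2 ^ t) _ ⟩
            2 ^ t * (p ^ s * cliqueSum E t (P i) (subseqSum s t f)) ≤⟨ *-monoʳ-≤ (2 ^ t) (cliqueSum-subseq E p s t (P i) f ≤-refl) ⟩
            2 ^ t * (2 ^ t * p ^ t * cliqueSum E s (P i) f)
              ≤⟨ *-monoʳ-≤ (2 ^ t) (*-monoʳ-≤ (2 ^ t * p ^ t) (cliqueSum-mono E s (P-Z i) f≤)) ⟩
            2 ^ t * (2 ^ t * p ^ t * cliqueSum E s Z (λ z → incidences z i)) ≡⟨ lem₂ (2 ^ t) (p ^ t) _ ⟩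
            2 ^ t * 2 ^ t * cliqueSum E s Z (λ z → incidences z i) * p ^ t ∎)
            where
            open ≤-Reasoning
            p-nonZero : NonZero p
            p-nonZero = >-nonZero (≤-trans (>-nonZero⁻¹ (4 * t) {{m*n≢0 4 t}}) large)
            f : Vec (Fin n) s → ℕ
            f = poor A T h ∘ Vec.map (ρ i)
            f≤ : ∀ z → InClique E (P i) z → f z ≤ incidences z i
            f≤ z c = incidence-pos i (Pointwise-map (ρ i) z (λ k → P-S i _ (InClique-∈ E z c k)))
              (P-T i _ (InClique-∈ E z c zero)) (All-map (ρ i) z (λ k → P-adj i _ (InClique-∈ E z c k)))
            lem₁ : ∀ a b c → a * (b * c) ≡ b * (a * c)
            lem₁ = solve-∀
            lem₂ : ∀ a b c → a * (a * b * c) ≡ a * a * c * b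
            lem₂ = solve-∀

        module _ (large : ∀ i → card (P i) ≡ 0 ⊎ π ≤ card (P i)) where

          -- For an unmerged `i` with `p ≥ π` centres in view, `π ^ s′ * p ≤ p ^ s`, so the weight
          -- `π ^ s′` turns what `i` sees into incidences. Merged vertices are paid for by `gain`.
          weighted-bound : π ^ s′ * sumFin n (λ i → card (P i)) ≤
            π ^ s′ * (κ * totalDegree E) + 2 ^ t * 2 ^ t * (q ^ s * h * cliques E s Z)
          weighted-bound = begin
            π ^ s′ * sumFin n (λ i → card (P i)) ≡⟨ sym (Σ-*ˡ n (π ^ s′) _) ⟩
            sumFin n (λ i → π ^ s′ * card (P i)) ≤⟨ Σ-mono n term ⟩
            sumFin n (λ i → π ^ s′ * (𝟙 (is-just (attach i)) * card (P i)) + B * cliqueSum E s Z (λ z → incidences z i))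
              ≡⟨ trans (Σ-+ n _ _) (cong₂ _+_ (Σ-*ˡ n (π ^ s′) _) (trans (Σ-*ˡ n B _) (cong (B *_) (Σ-cliqueSum E n s Z (λ i z → incidences z i))))) ⟩
            π ^ s′ * sumFin n (λ i → 𝟙 (is-just (attach i)) * card (P i)) + B * cliqueSum E s Z (λ z → sumFin n (incidences z))
              -- The factor 1 lets `cliqueSum-*ʳ` split off the number of cliques.
              ≤⟨ +-mono-≤ (*-monoʳ-≤ (π ^ s′) gain) (*-monoʳ-≤ B (cliqueSum-mono E s {U = Z} {g = λ _ → 1 * (q ^ s * h)} (λ _ e → e)
                   (λ z _ → ≤-trans (Σ-incidences z) (≤-reflexive (sym (+-identityʳ _)))))) ⟩
            π ^ s′ * (κ * totalDegree E) + B * cliqueSum E s Z (λ _ → 1 * (q ^ s * h))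
              ≡⟨ cong (λ x → π ^ s′ * (κ * totalDegree E) + B * x) (trans (cliqueSum-*ʳ E s Z (λ _ → 1) (q ^ s * h)) (*-comm (cliques E s Z) (q ^ s * h))) ⟩
            π ^ s′ * (κ * totalDegree E) + B * (q ^ s * h * cliques E s Z) ∎
            where
            open ≤-Reasoning
            B = 2 ^ t * 2 ^ t
            term : ∀ i → π ^ s′ * card (P i) ≤ π ^ s′ * (𝟙 (is-just (attach i)) * card (P i)) + B * cliqueSum E s Z (λ z → incidences z i)
            term i with large i
            ... | inj₁ p≡0 = ≤-trans (≤-reflexive (trans (cong (π ^ s′ *_) p≡0) (*-zeroʳ (π ^ s′)))) z≤n
            ... | inj₂ π≤p with attach i in eq
            ...   | just _ = ≤-trans (≤-reflexive (cong (π ^ s′ *_) (sym (+-identityʳ _)))) (m≤m+n _ _)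
            ...   | nothing = ≤-trans
              (≤-trans (*-monoˡ-≤ (card (P i)) (^-monoˡ-≤ s′ π≤p)) (≤-trans (≤-reflexive (*-comm _ (card (P i))))
                (saturated-incidences i eq (≤-trans (m≤m*n (4 * t) Q) π≤p))))
              (m≤n+m _ _)

          -- The incidence term contains `q ^ s * D ^ s′ = D * Q ^ s′`, and `Q ^ s′ ≤ π ^ s′`. So
          -- both terms carry the weight `π ^ s′`, which cancels.
          core-bound : DenseMinor G D ⊎ sumFin n (λ i → card (P i)) ≤ C₁ * D * card Z
          core-bound with few-edges
          ... | inj₁ minor = inj₁ minor
          ... | inj₂ edges with few-cliques
          ...   | inj₁ minor = inj₁ minor
          ...   | inj₂ cl = inj₂ (*-cancelˡ-≤ (π ^ s′) {{m^n≢0 π s′}} (begin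
            π ^ s′ * sumFin n (λ i → card (P i)) ≤⟨ weighted-bound ⟩
            π ^ s′ * (κ * totalDegree E) + B * (q ^ s * h * cliques E s Z)
              ≤⟨ +-mono-≤ (*-monoʳ-≤ (π ^ s′) (*-monoʳ-≤ κ edges)) (*-monoʳ-≤ B (*-monoʳ-≤ (q ^ s * h) cl)) ⟩
            π ^ s′ * (κ * (D * card Z)) + B * (q ^ s * h * (s * D ^ s′ * card Z))
              ≡⟨ cong (λ x → π ^ s′ * (κ * (D * card Z)) + B * (q ^ s * h * (s * x * card Z))) (^-distribʳ-* s′ q Q) ⟩
            π ^ s′ * (κ * (D * card Z)) + B * (q ^ s * h * (s * (q ^ s′ * Q ^ s′) * card Z))
              ≡⟨ cong (π ^ s′ * (κ * (D * card Z)) +_) (lem₁ B q (q ^ s′) h s (Q ^ s′) (card Z)) ⟩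
            π ^ s′ * (κ * (D * card Z)) + Q ^ s′ * (B * h * s * (q * (q ^ s′ * q ^ s′) * card Z))
              ≡⟨ cong (λ x → π ^ s′ * (κ * (D * card Z)) + Q ^ s′ * (B * h * s * (q * x * card Z))) qq ⟩
            π ^ s′ * (κ * (D * card Z)) + Q ^ s′ * (B * h * s * (D * card Z))
              ≤⟨ +-monoʳ-≤ (π ^ s′ * (κ * (D * card Z))) (*-monoˡ-≤ _ (^-monoˡ-≤ s′ (m≤n*m Q (4 * t) {{m*n≢0 4 t}}))) ⟩
            π ^ s′ * (κ * (D * card Z)) + π ^ s′ * (B * h * s * (D * card Z))
              ≡⟨ lem₂ (π ^ s′) κ (B * h * s) D (card Z) ⟩
            π ^ s′ * (C₁ * D * card Z) ∎))
            where
            open ≤-Reasoning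
            B = 2 ^ t * 2 ^ t
            qq : q ^ s′ * q ^ s′ ≡ Q
            qq = trans (sym (^-distribˡ-+-* q s′ s′)) (cong (λ x → q ^ (s′ + x)) (sym (+-identityʳ s′)))
            lem₁ : ∀ B q a h s c z → B * (q * a * h * (s * (a * c) * z)) ≡ c * (B * h * s * (q * (a * a) * z))
            lem₁ = solve-∀
            lem₂ : ∀ x k b d z → x * (k * (d * z)) + x * (b * (d * z)) ≡ x * ((k + b) * d * z)
            lem₂ = solve-∀

    module _ (P : Fin n → Fin n → Bool) (ρ : Fin n → Fin n → Fin n)
      (P-T : ∀ i w → P i w ≡ true → T i ≡ true) (P-Z : ∀ i w → P i w ≡ true → Z w ≡ true)
      (P-S : ∀ i w → P i w ≡ true → S w (ρ i w) ≡ true) (P-adj : ∀ i w → P i w ≡ true → Adj G i (ρ i w)) where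

      private
        P′ : Fin n → Fin n → Bool
        P′ i w = P i w ∧ (π ≤ᵇ card (P i))

        P′⊆P : ∀ i w → P′ i w ≡ true → P i w ≡ true
        P′⊆P i w e = proj₁ (∧-elim {P i w} e)

        P′-large : ∀ i → card (P′ i) ≡ 0 ⊎ π ≤ card (P′ i)
        P′-large i with π ≤ᵇ card (P i) in eq
        ... | true  = inj₂ (≤-trans (≤ᵇ⇒≤ π _ (subst Bool.T (sym eq) tt)) (card-mono {p = P i} (λ w e → ∧-intro e refl)))
        ... | false = inj₁ (trans (Σ-cong n (λ w → cong 𝟙 (∧-zeroʳ (P i w)))) (Σ-zero n))

        lost : ∀ i → card (P i) ≤ card (P′ i) + π * 𝟙 (T i)
        lost i with π ≤ᵇ card (P i) in eq
        ... | true  = ≤-trans (card-mono {p = P i} (λ w e → ∧-intro e refl)) (m≤m+n _ _)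
        ... | false with T i in Ti
        ...   | true  = ≤-trans (<⇒≤ (≰⇒> (λ le → subst Bool.T eq (≤⇒≤ᵇ le))))
                          (≤-trans (≤-reflexive (sym (*-identityʳ π))) (m≤n+m _ _))
        ...   | false = ≤-trans (≮⇒≥ (λ pos → let (w , e) = card-inhab (P i) pos in true≢false (P-T i w e) Ti)) z≤n

      -- Emptying the view of every vertex that sees fewer than `π` centres loses at most `π` for
      -- each vertex of `T`.
      core : DenseMinor G D ⊎ sumFin n (λ i → card (P i)) ≤ C₁ * D * card Z + π * card T
      core with core-bound P′ ρ (λ i w e → P-T i w (P′⊆P i w e)) (λ i w e → P-Z i w (P′⊆P i w e))
                  (λ i w e → P-S i w (P′⊆P i w e)) (λ i w e → P-adj i w (P′⊆P i w e)) (greedy-attachment κ n P′) P′-large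
      ... | inj₁ minor = inj₁ minor
      ... | inj₂ le = inj₂ (begin
        sumFin n (λ i → card (P i)) ≤⟨ Σ-mono n lost ⟩
        sumFin n (λ i → card (P′ i) + π * 𝟙 (T i)) ≡⟨ trans (Σ-+ n _ _) (cong (sumFin n (λ i → card (P′ i)) +_) (Σ-*ˡ n π _)) ⟩
        sumFin n (λ i → card (P′ i)) + π * card T ≤⟨ +-monoˡ-≤ (π * card T) le ⟩
        C₁ * D * card Z + π * card T ∎)
        where open ≤-Reasoning

-- Cuts and star packings

cut : ∀ {n} → (Fin n → Fin n → Bool) → (Fin n → Bool) → ℕ
cut {n} A X = sumFin n (λ y → card (λ x → not (X y) ∧ (X x ∧ A y x)))

-- `totalDegree` counts each edge twice and `cut` counts it once, so at least half of the edges
-- cross. Each new vertex is put on the side with fewer of its neighbours among the vertices already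
-- placed.
large-cut : ∀ n (A : Fin n → Fin n → Bool) → (∀ u v → A u v ≡ A v u) → (∀ v → A v v ≡ false) →
  ∃ λ X → totalDegree A ≤ 4 * cut A X
large-cut zero A A-sym A-irrefl = (λ ()) , z≤n
large-cut (suc n) A A-sym A-irrefl = decide (a ≤? b)
  where
  A′ : Fin n → Fin n → Bool
  A′ u v = A (suc u) (suc v)
  IH = large-cut n A′ (λ u v → A-sym (suc u) (suc v)) (λ v → A-irrefl (suc v))
  X = proj₁ IH
  nbr : Fin n → Bool
  nbr v = A zero (suc v)
  a = card (λ x → X x ∧ nbr x)
  b = card (λ y → not (X y) ∧ nbr y)
  nbr≡ : card nbr ≡ a + b
  nbr≡ = trans (Σ-cong n term) (Σ-+ n _ _)
    where
    term : ∀ v → 𝟙 (nbr v) ≡ 𝟙 (X v ∧ nbr v) + 𝟙 (not (X v) ∧ nbr v)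
    term v with X v | nbr v
    ... | true  | true  = refl
    ... | true  | false = refl
    ... | false | true  = refl
    ... | false | false = refl
  total≡ : totalDegree A ≡ 2 * (a + b) + totalDegree A′
  total≡ = begin
    𝟙 (A zero zero) + card nbr + sumFin n (λ u → 𝟙 (A (suc u) zero) + card (A′ u))
      ≡⟨ cong₂ _+_ (cong (λ x → 𝟙 x + card nbr) (A-irrefl zero)) (Σ-+ n _ _) ⟩
    card nbr + (sumFin n (λ u → 𝟙 (A (suc u) zero)) + totalDegree A′)
      ≡⟨ cong (λ x → card nbr + (x + totalDegree A′)) (Σ-cong n (λ u → cong 𝟙 (A-sym (suc u) zero))) ⟩
    card nbr + (card nbr + totalDegree A′) ≡⟨ cong (λ x → x + (x + totalDegree A′)) nbr≡ ⟩
    (a + b) + ((a + b) + totalDegree A′) ≡⟨ lem (a + b) (totalDegree A′) ⟩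
    2 * (a + b) + totalDegree A′ ∎
    where
    open ≡-Reasoning
    lem : ∀ x y → x + (x + y) ≡ 2 * x + y
    lem = solve-∀
  X⁺ : Bool → Fin (suc n) → Bool
  X⁺ c zero    = c
  X⁺ c (suc v) = X v
  cut-true : b + cut A′ X ≤ cut A (X⁺ true)
  cut-true = ≤-trans (≤-reflexive (sym (Σ-+ n _ _)))
    (≤-trans (Σ-mono n (λ y → +-monoˡ-≤ _ (𝟙-mono {not (X y) ∧ nbr y} (λ e → let (p , r) = ∧-elim {not (X y)} e in
      ∧-intro p (trans (A-sym (suc y) zero) r))))) (m≤n+m _ _))
  cut-false : a + cut A′ X ≤ cut A (X⁺ false)
  cut-false = +-monoʳ-≤ a (Σ-mono n (λ y → m≤n+m _ _))
  bound : ∀ {c m} → a + b ≤ m + m → m + cut A′ X ≤ c → totalDegree A ≤ 4 * c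
  bound {c} {m} le mc = begin
    totalDegree A ≡⟨ total≡ ⟩
    2 * (a + b) + totalDegree A′ ≤⟨ +-mono-≤ (*-monoʳ-≤ 2 le) (proj₂ IH) ⟩
    2 * (m + m) + 4 * cut A′ X ≡⟨ lem m (cut A′ X) ⟩
    4 * (m + cut A′ X) ≤⟨ *-monoʳ-≤ 4 mc ⟩
    4 * c ∎
    where
    open ≤-Reasoning
    lem : ∀ x y → 2 * (x + x) + 4 * y ≡ 4 * (x + y)
    lem = solve-∀
  decide : Dec (a ≤ b) → ∃ λ X → totalDegree A ≤ 4 * cut A X
  decide (yes a≤b) = X⁺ true , bound (+-monoˡ-≤ b a≤b) cut-true
  decide (no a≰b)  = X⁺ false , bound (+-monoʳ-≤ a (<⇒≤ (≰⇒> a≰b))) cut-false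

cut-complement : ∀ {n} (A : Fin n → Fin n → Bool) → (∀ u v → A u v ≡ A v u) → ∀ X → cut A X ≡ cut A (not ∘ X)
cut-complement {n} A A-sym X = trans (Σ-swap n n _) (Σ-cong n λ x → Σ-cong n λ y → cong 𝟙 (term y x))
  where
  term : ∀ y x → not (X y) ∧ (X x ∧ A y x) ≡ not (not (X x)) ∧ (not (X y) ∧ A x y)
  term y x rewrite A-sym y x with X y | X x
  ... | true  | true  = refl
  ... | true  | false = refl
  ... | false | true  = refl
  ... | false | false = refl

balanced-cut : ∀ {n} (A : Fin n → Fin n → Bool) → (∀ u v → A u v ≡ A v u) → (∀ v → A v v ≡ false) →
  ∃ λ X → totalDegree A ≤ 4 * cut A X × card (not ∘ X) ≤ card X
balanced-cut {n} A A-sym A-irrefl with large-cut n A A-sym A-irrefl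
... | X , big with card (not ∘ X) ≤? card X
...   | yes le = X , big , le
...   | no ≰ = not ∘ X , ≤-trans big (≤-reflexive (cong (4 *_) (cut-complement A A-sym X))) ,
  ≤-trans (card-mono (λ v → trans (sym (not-involutive (X v))))) (<⇒≤ (≰⇒> ≰))

hasLabel : ∀ {n} → Maybe (Fin n) → Fin n → Bool
hasLabel nothing  w = false
hasLabel (just v) w = v == w

hasLabel-sound : ∀ {n} (m : Maybe (Fin n)) {w} → hasLabel m w ≡ true → m ≡ just w
hasLabel-sound (just v) e = cong just (==-sound e)

-- `label x` is the centre of the star with leaf `x`. The list `e` holds the candidates tried so
-- far, and maximality is claimed for these only.
record StarPacking {m} (G : Graph) (X : Fin (order G) → Bool) (q : ℕ) (e : Fin m → Fin (order G)) : Set where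
  field
    label     : Fin (order G) → Maybe (Fin (order G))
    Z         : Fin (order G) → Bool
    label-X   : ∀ x w → label x ≡ just w → X x ≡ true
    label-Z   : ∀ x w → label x ≡ just w → Z w ≡ true
    label-adj : ∀ x w → label x ≡ just w → Adj G x w
    Z-X       : ∀ w → Z w ≡ true → X w ≡ false
    star-size : ∀ w → card (λ x → hasLabel (label x) w) ≤ q
    Z-size    : q * card Z ≤ card (λ x → is-just (label x))
  unused : Fin (order G) → ℕ
  unused y = card (λ x → X x ∧ (not (is-just (label x)) ∧ adj G y x))
  field
    maximal   : ∀ i → X (e i) ≡ false → Z (e i) ≡ false → unused (e i) ≤ q

-- A rejected candidate stays rejected, because the unpacked part of `X` only shrinks.
star-packing : ∀ (G : Graph) (X : Fin (order G) → Bool) q m (e : Fin m → Fin (order G)) → StarPacking G X q e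
star-packing G X q zero e = record
  { label = λ _ → nothing ; Z = λ _ → false ; label-X = λ _ _ () ; label-Z = λ _ _ () ; label-adj = λ _ _ ()
  ; Z-X = λ _ () ; star-size = λ _ → ≤-trans (≤-reflexive (Σ-zero (order G))) z≤n
  ; Z-size = ≤-trans (≤-reflexive (trans (cong (q *_) (Σ-zero (order G))) (*-zeroʳ q))) z≤n
  ; maximal = λ () }
star-packing G X q (suc m) e = decide (X y) refl (Z y) refl (q ≤? unused y)
  where
  n = order G
  old = star-packing G X q m (e ∘ suc)
  open StarPacking old
  y = e zero
  unchanged : (X y ≡ false → Z y ≡ false → unused y ≤ q) → StarPacking G X q e
  unchanged max = record
    { label = label ; Z = Z ; label-X = label-X ; label-Z = label-Z ; label-adj = label-adj ; Z-X = Z-X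
    ; star-size = star-size ; Z-size = Z-size ; maximal = λ { zero → max ; (suc i) → maximal i } }
  module Extended (y∉X : X y ≡ false) (y∉Z : Z y ≡ false) (R : Fin n → Bool)
    (R⊆ : ∀ x → R x ≡ true → X x ∧ (not (is-just (label x)) ∧ adj G y x) ≡ true) (|R| : card R ≡ q) where
    label⁺ : Fin n → Maybe (Fin n)
    label⁺ x = if R x then just y else label x
    Z⁺ : Fin n → Bool
    Z⁺ w = Z w ∨ (w == y)
    elim : ∀ x w → label⁺ x ≡ just w → (R x ≡ true × w ≡ y) ⊎ label x ≡ just w
    elim x w eq with R x
    ... | true  = inj₁ (refl , sym (just-injective eq))
    ... | false = inj₂ eq
    label-X⁺ : ∀ x w → label⁺ x ≡ just w → X x ≡ true
    label-X⁺ x w eq with elim x w eq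
    ... | inj₁ (Rx , _) = proj₁ (∧-elim {X x} (R⊆ x Rx))
    ... | inj₂ eq′ = label-X x w eq′
    label-Z⁺ : ∀ x w → label⁺ x ≡ just w → Z⁺ w ≡ true
    label-Z⁺ x w eq with elim x w eq
    ... | inj₁ (_ , refl) = ∨-introʳ (Z w) (==-refl w)
    ... | inj₂ eq′ = ∨-introˡ _ (label-Z x w eq′)
    label-adj⁺ : ∀ x w → label⁺ x ≡ just w → Adj G x w
    label-adj⁺ x w eq with elim x w eq
    ... | inj₁ (Rx , refl) = trans (adj-sym G x y)
      (proj₂ (∧-elim {not (is-just (label x))} (proj₂ (∧-elim {X x} (R⊆ x Rx)))))
    ... | inj₂ eq′ = label-adj x w eq′
    Z-X⁺ : ∀ w → Z⁺ w ≡ true → X w ≡ false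
    Z-X⁺ w eq with ∨-elim {Z w} eq
    ... | inj₁ Zw = Z-X w Zw
    ... | inj₂ w≡y = trans (cong X (==-sound w≡y)) y∉X
    label-y : ∀ x → ¬ (label x ≡ just y)
    label-y x eq = true≢false (label-Z x y eq) y∉Z
    star-size⁺ : ∀ w → card (λ x → hasLabel (label⁺ x) w) ≤ q
    star-size⁺ w with w Fin.≟ y
    ... | yes refl = ≤-trans (card-mono {p' = R} (λ x l → case elim x w (hasLabel-sound (label⁺ x) l) of λ
        { (inj₁ (Rx , _)) → Rx ; (inj₂ eq) → ⊥-elim (label-y x eq) })) (≤-reflexive |R|)
    ... | no w≢y = ≤-trans (card-mono {p' = λ x → hasLabel (label x) w} (λ x l → case elim x w (hasLabel-sound (label⁺ x) l) of λ
        { (inj₁ (_ , w≡y)) → ⊥-elim (w≢y w≡y) ; (inj₂ eq) → trans (cong (λ m → hasLabel m w) eq) (==-refl w) })) (star-size w)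
    Z-size⁺ : q * card Z⁺ ≤ card (λ x → is-just (label⁺ x))
    Z-size⁺ = begin
      q * card Z⁺ ≤⟨ *-monoʳ-≤ q (Σ-mono n (λ w → ∨-≤ (Z w) (w == y))) ⟩
      q * sumFin n (λ w → 𝟙 (w == y) + 𝟙 (Z w)) ≡⟨ cong (q *_) (trans (Σ-+ n _ _) (cong (_+ card Z) (card-single y))) ⟩
      q * suc (card Z) ≡⟨ *-suc q (card Z) ⟩
      q + q * card Z ≤⟨ +-mono-≤ (≤-reflexive (sym |R|)) Z-size ⟩
      card R + card (λ x → is-just (label x)) ≡⟨ sym (Σ-+ n _ _) ⟩
      sumFin n (λ x → 𝟙 (R x) + 𝟙 (is-just (label x))) ≤⟨ Σ-mono n used ⟩
      card (λ x → is-just (label⁺ x)) ∎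
      where
      open ≤-Reasoning
      ∨-≤ : ∀ a b → 𝟙 (a ∨ b) ≤ 𝟙 b + 𝟙 a
      ∨-≤ true  b = m≤n+m 1 (𝟙 b)
      ∨-≤ false b = m≤m+n (𝟙 b) 0
      used : ∀ x → 𝟙 (R x) + 𝟙 (is-just (label x)) ≤ 𝟙 (is-just (label⁺ x))
      used x with R x in Rx
      ... | false = ≤-refl
      ... | true rewrite not-true (proj₁ (∧-elim {not (is-just (label x))} (proj₂ (∧-elim {X x} (R⊆ x Rx))))) = ≤-refl
    maximal⁺ : ∀ i → X (e i) ≡ false → Z⁺ (e i) ≡ false →
      card (λ x → X x ∧ (not (is-just (label⁺ x)) ∧ adj G (e i) x)) ≤ q
    maximal⁺ zero    _ Z⁺y = ⊥-elim (true≢false (∨-introʳ (Z y) (==-refl y)) Z⁺y)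
    maximal⁺ (suc i) Xi Zi = ≤-trans (card-mono fewer) (maximal i Xi (≢true⇒false (λ Zt → true≢false (∨-introˡ _ Zt) Zi)))
      where
      fewer : ∀ x → X x ∧ (not (is-just (label⁺ x)) ∧ adj G (e (suc i)) x) ≡ true →
        X x ∧ (not (is-just (label x)) ∧ adj G (e (suc i)) x) ≡ true
      fewer x eq with R x
      ... | false = eq
      ... | true  = ⊥-elim (true≢false (proj₂ (∧-elim {X x} eq)) refl)
    extended : StarPacking G X q e
    extended = record
      { label = label⁺ ; Z = Z⁺ ; label-X = label-X⁺ ; label-Z = label-Z⁺ ; label-adj = label-adj⁺ ; Z-X = Z-X⁺
      ; star-size = star-size⁺ ; Z-size = Z-size⁺ ; maximal = maximal⁺ }
  decide : ∀ a → X y ≡ a → ∀ b → Z y ≡ b → Dec (q ≤ unused y) → StarPacking G X q e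
  decide true  Xy _     _  _        = unchanged (λ f → ⊥-elim (true≢false Xy f))
  decide false Xy true  Zy _        = unchanged (λ _ f → ⊥-elim (true≢false Zy f))
  decide false Xy false Zy (no ≰)   = unchanged (λ _ _ → <⇒≤ (≰⇒> ≰))
  -- Exactly `q` leaves are taken: `star-size` allows no more and `Z-size` no fewer.
  decide false Xy false Zy (yes le) with subset-of-card (λ x → X x ∧ (not (is-just (label x)) ∧ adj G y x)) q le
  ... | R , R⊆ , |R| = Extended.extended Xy Zy R R⊆ |R|

-- Bounding the edges across a balanced cut

T⇒true : ∀ {b} → Bool.T b → b ≡ true
T⇒true {true} _ = refl

All-tabulate : ∀ {A : Set} {k} {Q : A → Set} (f : Fin k → A) → (∀ i → Q (f i)) → All Q (tabulate f)
All-tabulate {k = zero}  f q = []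
All-tabulate {k = suc k} f q = q zero ∷ All-tabulate (f ∘ suc) (q ∘ suc)

Pointwise-replicate : ∀ {n k} {S : Fin n → Fin n → Bool} w {x : Vec (Fin n) k} →
  All (λ y → S w y ≡ true) x → Pointwise (λ w y → S w y ≡ true) (replicate k w) x
Pointwise-replicate w []       = []
Pointwise-replicate w (a ∷ as) = a ∷ Pointwise-replicate w as

distinct-tuple : ∀ {n} t (p : Fin n → Bool) → t ≤ card p →
  ∃ λ (z : Vec (Fin n) t) → Distinct z × All (λ x → p x ≡ true) z
distinct-tuple t p le = tabulate f , distinct , All-tabulate f (λ i → elem-∈ _)
  where
  open Enumeration (enumerate p)
  t≤size : t ≤ size
  t≤size = subst (t ≤_) (sym size≡card) le
  f : Fin t → _
  f i = elem (inject≤ i t≤size)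
  distinct : Distinct (tabulate f)
  distinct i j eq = Fin.inject≤-injective t≤size t≤size i j (just-injective
    (trans (sym (index-elem _)) (trans (cong index (trans (sym (lookup∘tabulate f i)) (trans eq (lookup∘tabulate f j)))) (index-elem _))))

module CutBound (G H : Graph) (s′ : ℕ) .{{_ : NonZero s′}} (bip : BipartiteBDeg≤ H (suc s′)) (free : HFree H G) (q : ℕ) .{{_ : NonZero q}}
  (X : Fin (order G) → Bool) (Y≤X : card (not ∘ X) ≤ card X) where

  open Counting G H s′ bip free q
  open StarPacking (star-packing G X q (order G) (λ v → v))

  qZ≤X : q * card Z ≤ card X
  qZ≤X = ≤-trans Z-size (card-mono sub)
    where
    sub : ∀ x → is-just (label x) ≡ true → X x ≡ true
    sub x e with label x in eq
    ... | just w = label-X x w eq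

  -- For the edges between `X` and `Z`: the branch sets are single centres, and every vertex of `X`
  -- may be merged, packed or not.
  centres : StarSystem G q
  centres = record
    { T = X ; Z = Z ; β = β ; S = λ w x → Z x ∧ (x == w)
    ; T-free = λ i Xi → βf i (≢true⇒false (λ Zi → true≢false Xi (Z-X i Zi)))
    ; Z-root = βt
    ; β-star = λ x w e → inj₁ (proj₂ (β-elim x w e))
    ; β-Z = λ x w e → subst (λ v → Z v ≡ true) (proj₂ (β-elim x w e)) (proj₁ (β-elim x w e))
    ; S-β = λ w x e → let (Zx , x≡w) = ∧-elim {Z x} e in trans (βt x Zx) (cong just (==-sound x≡w))
    ; S-small = λ w → ≤-trans (card-mono (λ x e → proj₂ (∧-elim {Z x} e))) (≤-trans (≤-reflexive (card-single w)) (>-nonZero⁻¹ q)) }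
    where
    β : Fin n → Maybe (Fin n)
    β x = if Z x then just x else nothing
    βt : ∀ x → Z x ≡ true → β x ≡ just x
    βt x e rewrite e = refl
    βf : ∀ x → Z x ≡ false → β x ≡ nothing
    βf x e rewrite e = refl
    β-elim : ∀ x w → β x ≡ just w → Z x ≡ true × x ≡ w
    β-elim x w e with Z x
    ... | true = refl , just-injective e

  centre-edges : DenseMinor G D ⊎ sumFin n (λ x → card (λ w → X x ∧ (Z w ∧ A x w))) ≤ C₁ * D * card Z + π * card X
  centre-edges = core centres (λ x w → X x ∧ (Z w ∧ A x w)) (λ _ w → w)
    (λ x w e → proj₁ (∧-elim {X x} e))
    (λ x w e → proj₁ (∧-elim {Z w} (proj₂ (∧-elim {X x} e))))
    (λ x w e → ∧-intro (proj₁ (∧-elim {Z w} (proj₂ (∧-elim {X x} e)))) (==-refl w))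
    (λ x w e → proj₂ (∧-elim {Z w} (proj₂ (∧-elim {X x} e))))

  T : Fin n → Bool
  T y = not (X y) ∧ not (Z y)

  leaf : Fin n → Fin n → Bool
  leaf w x = hasLabel (label x) w

  -- For the edges between the packed leaves and `Y ∖ Z`: the branch sets are whole stars, and
  -- contacts are made at the leaves.
  stars : StarSystem G q
  stars = record
    { T = T ; Z = Z ; β = β ; S = leaf
    ; T-free = T-free
    ; Z-root = λ w Zw → cong (λ b → if b then just w else label w) Zw
    ; β-star = β-star ; β-Z = β-Z ; S-β = S-β ; S-small = star-size }
    where
    β : Fin n → Maybe (Fin n)
    β x = if Z x then just x else label x
    T-free : ∀ i → T i ≡ true → β i ≡ nothing
    T-free i Ti with ∧-elim {not (X i)} Ti
    ... | ¬X , ¬Z rewrite not-true ¬Z with label i in eq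
    ...   | nothing = refl
    ...   | just w  = ⊥-elim (true≢false (label-X i w eq) (not-true ¬X))
    β-star : ∀ x w → β x ≡ just w → x ≡ w ⊎ Adj G x w
    β-star x w e with Z x
    ... | true  = inj₁ (just-injective e)
    ... | false = inj₂ (label-adj x w e)
    β-Z : ∀ x w → β x ≡ just w → Z w ≡ true
    β-Z x w e with Z x in Zx
    ... | true  = subst (λ v → Z v ≡ true) (just-injective e) Zx
    ... | false = label-Z x w e
    S-β : ∀ w x → leaf w x ≡ true → β x ≡ just w
    S-β w x e with Z x in Zx
    ... | true  = ⊥-elim (true≢false (label-X x w (hasLabel-sound (label x) e)) (Z-X x Zx))
    ... | false = hasLabel-sound (label x) e

  leafNbrs : Fin n → Fin n → ℕ
  leafNbrs y w = card (λ x → leaf w x ∧ A y x)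

  sees : Fin n → Fin n → Bool
  sees y w = T y ∧ (Z w ∧ (0 <ᵇ leafNbrs y w))

  contact : ∀ y w → Dec (∃ λ x → leaf w x ∧ A y x ≡ true)
  contact y w = Fin.any? (λ x → (leaf w x ∧ A y x) Bool.≟ true)

  representative : Fin n → Fin n → Fin n
  representative y w with contact y w
  ... | yes (x , _) = x
  -- A default value; `sees y w` rules this case out.
  ... | no _        = y

  representative-spec : ∀ y w → sees y w ≡ true → leaf w (representative y w) ∧ A y (representative y w) ≡ true
  representative-spec y w e with contact y w
  ... | yes (x , p) = p
  ... | no none = ⊥-elim (none (card-inhab _ (<ᵇ⇒< 0 (leafNbrs y w)
      (subst Bool.T (sym (proj₂ (∧-elim {Z w} (proj₂ (∧-elim {T y} e))))) tt))))

  star-views : DenseMinor G D ⊎ sumFin n (λ y → card (sees y)) ≤ C₁ * D * card Z + π * card T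
  star-views = core stars sees representative
    (λ y w e → proj₁ (∧-elim {T y} e))
    (λ y w e → proj₁ (∧-elim {Z w} (proj₂ (∧-elim {T y} e))))
    (λ y w e → proj₁ (∧-elim {leaf w (representative y w)} (representative-spec y w e)))
    (λ y w e → proj₂ (∧-elim {leaf w (representative y w)} (representative-spec y w e)))

  -- Only distinct stars seen by y yield edges of the minor; a star with at least t neighbours of y contains a
  -- poor tuple adjacent to y, so such pairs are too rare to matter.
  heavy : Fin n → Fin n → Bool
  heavy w y = T y ∧ (t ≤ᵇ leafNbrs y w)

  -- All entries of the poor tuple come from the one star at `w`, so the relevant product is over
  -- `replicate s w`.
  heavy-few : ∀ w → card (heavy w) ≤ q ^ s * h
  heavy-few w = ≤-trans (Σ-mono n (λ y → 𝟙-≤ (heavy w y) (incident y))) (Σ-incidences stars (replicate s w))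
    where
    incident : ∀ y → heavy w y ≡ true → 1 ≤ incidences stars (replicate s w) y
    incident y e =
      let (Ty , big) = ∧-elim {T y} e
          (z , distinct , allz) = distinct-tuple t (λ x → leaf w x ∧ A y x) (≤ᵇ⇒≤ t _ (subst Bool.T (sym big) tt))
          outside = λ i → S∉T stars w (lookup z i) (proj₁ (∧-elim {leaf w (lookup z i)} (lookup⁺ allz i)))
          (x , poor-x , sub) = subseqSum-pos s t (poor A T h) z (distinct-tuple-poor G H s bip free T z distinct outside)
          allx = sub _ allz
      in ≤-trans poor-x (incidence-pos stars y
           (Pointwise-replicate w (All.map (λ {v} a → proj₁ (∧-elim {leaf w v} a)) allx)) Ty
           (All.map (λ {v} a → proj₂ (∧-elim {leaf w v} a)) allx))

  leafNbrs-Z : ∀ y w → 1 ≤ leafNbrs y w → Z w ≡ true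
  leafNbrs-Z y w pos = let (x , e) = card-inhab (λ x → leaf w x ∧ A y x) pos in
    label-Z x w (hasLabel-sound (label x) (proj₁ (∧-elim {leaf w x} e)))

  -- A star with fewer than `t` neighbours of `y` is paid for by `sees`; any other is heavy and has
  -- at most `q` leaves.
  leafNbrs-bound : ∀ y w → T y ≡ true → leafNbrs y w ≤ t * 𝟙 (sees y w) + q * (𝟙 (Z w) * 𝟙 (heavy w y))
  leafNbrs-bound y w Ty with 1 ≤? leafNbrs y w
  ... | no none = ≤-trans (≮⇒≥ none) z≤n
  ... | yes pos with t ≤? leafNbrs y w
  ...   | yes big = begin
    leafNbrs y w ≤⟨ card-mono (λ x e → proj₁ (∧-elim {leaf w x} e)) ⟩
    card (leaf w) ≤⟨ star-size w ⟩
    q ≡⟨ sym (*-identityʳ q) ⟩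
    q * 1 ≤⟨ *-monoʳ-≤ q (≤-𝟙* (leafNbrs-Z y w pos) (𝟙-true (∧-intro Ty (T⇒true (≤⇒≤ᵇ big))))) ⟩
    q * (𝟙 (Z w) * 𝟙 (heavy w y)) ≤⟨ m≤n+m _ _ ⟩
    t * 𝟙 (sees y w) + q * (𝟙 (Z w) * 𝟙 (heavy w y)) ∎
    where open ≤-Reasoning
  ...   | no ≰ = begin
    leafNbrs y w ≤⟨ <⇒≤ (≰⇒> ≰) ⟩
    t ≡⟨ sym (*-identityʳ t) ⟩
    t * 1 ≤⟨ *-monoʳ-≤ t (𝟙-true (∧-intro Ty (∧-intro (leafNbrs-Z y w pos) (T⇒true (<⇒<ᵇ pos))))) ⟩
    t * 𝟙 (sees y w) ≤⟨ m≤m+n _ _ ⟩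
    t * 𝟙 (sees y w) + q * (𝟙 (Z w) * 𝟙 (heavy w y)) ∎
    where open ≤-Reasoning

  -- A centre `y` is covered by the first term. Any other `y` outside `X` has its neighbours in `X`
  -- split into packed leaves, grouped by star, and at most `q` unpacked vertices, by maximality.
  row : ∀ y → card (λ x → not (X y) ∧ (X x ∧ A y x)) ≤
    card (λ x → X x ∧ (Z y ∧ A x y)) + (sumFin n (λ w → t * 𝟙 (sees y w) + q * (𝟙 (Z w) * 𝟙 (heavy w y))) + q * 𝟙 (T y))
  row y = cases (X y) refl (Z y) refl
    where
    open ≤-Reasoning
    views = sumFin n (λ w → t * 𝟙 (sees y w) + q * (𝟙 (Z w) * 𝟙 (heavy w y)))
    term : ∀ x → 𝟙 (X x ∧ A y x) ≤ sumFin n (λ w → 𝟙 (leaf w x ∧ A y x)) + 𝟙 (X x ∧ (not (is-just (label x)) ∧ A y x))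
    term x with label x
    ... | nothing = m≤n+m _ _
    ... | just w = ≤-trans (≤-trans (𝟙-mono {X x ∧ A y x} (λ e → ∧-intro (==-refl w) (proj₂ (∧-elim {X x} e))))
                     (Σ-term n (λ v → 𝟙 ((w == v) ∧ A y x)) w)) (m≤m+n _ _)
    cases : ∀ a → X y ≡ a → ∀ b → Z y ≡ b → card (λ x → not (X y) ∧ (X x ∧ A y x)) ≤
      card (λ x → X x ∧ (Z y ∧ A x y)) + (views + q * 𝟙 (T y))
    cases true Xy _ _ = ≤-trans (≮⇒≥ (λ pos → let (x , e) = card-inhab (λ x → not (X y) ∧ (X x ∧ A y x)) pos in
      true≢false Xy (not-true (proj₁ (∧-elim {not (X y)} e))))) z≤n
    cases false Xy true Zy = ≤-trans (card-mono (λ x e →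
      let (a , b) = ∧-elim {X x} (proj₂ (∧-elim {not (X y)} e)) in ∧-intro a (∧-intro Zy (trans (adj-sym G x y) b)))) (m≤m+n _ _)
    cases false Xy false Zy = begin
      card (λ x → not (X y) ∧ (X x ∧ A y x)) ≤⟨ card-mono {p' = λ x → X x ∧ A y x} (λ x e → proj₂ (∧-elim {not (X y)} e)) ⟩
      card (λ x → X x ∧ A y x) ≤⟨ Σ-mono n term ⟩
      sumFin n (λ x → sumFin n (λ w → 𝟙 (leaf w x ∧ A y x)) + 𝟙 (X x ∧ (not (is-just (label x)) ∧ A y x)))
        ≡⟨ trans (Σ-+ n _ _) (cong (_+ unused y) (Σ-swap n n _)) ⟩
      sumFin n (λ w → leafNbrs y w) + unused y
        ≤⟨ +-mono-≤ (Σ-mono n (λ w → leafNbrs-bound y w Ty)) (maximal y Xy Zy) ⟩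
      views + q ≡⟨ cong (views +_) (sym (*-identityʳ q)) ⟩
      views + q * 1 ≤⟨ +-monoʳ-≤ views (*-monoʳ-≤ q (𝟙-true Ty)) ⟩
      views + q * 𝟙 (T y) ≤⟨ m≤n+m _ (card (λ x → X x ∧ (Z y ∧ A x y))) ⟩
      card (λ x → X x ∧ (Z y ∧ A x y)) + (views + q * 𝟙 (T y)) ∎
      where
      Ty : T y ≡ true
      Ty = ∧-intro (cong not Xy) (cong not Zy)

  -- The summands pay, in order, for edges at centres, for light stars seen, for heavy pairs and for
  -- unpacked neighbours.
  L₀ : ℕ
  L₀ = (C₁ + 4 * t) + t * (C₁ + 4 * t) + h + 1

  dense-minor-or-small-cut : DenseMinor G D ⊎ cut A X ≤ L₀ * Q * card X
  dense-minor-or-small-cut with centre-edges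
  ... | inj₁ minor = inj₁ minor
  ... | inj₂ a with star-views
  ...   | inj₁ minor = inj₁ minor
  ...   | inj₂ b = inj₂ (begin
    cut A X ≤⟨ Σ-mono n row ⟩
    sumFin n (λ y → card (λ x → X x ∧ (Z y ∧ A x y)) + (sumFin n (λ w → t * 𝟙 (sees y w) + q * (𝟙 (Z w) * 𝟙 (heavy w y))) + q * 𝟙 (T y)))
      ≡⟨ trans (Σ-+ n _ _) (cong₂ _+_ (Σ-swap n n _) (trans (Σ-+ n _ _) (cong₂ _+_
           (trans (Σ-cong n (λ y → Σ-+ n _ _)) (trans (Σ-+ n _ _) (cong₂ _+_
             (trans (Σ-cong n (λ y → Σ-*ˡ n t _)) (Σ-*ˡ n t _))
             (trans (Σ-swap n n _) (trans (Σ-cong n (λ w → trans (Σ-*ˡ n q _) (cong (q *_) (Σ-*ˡ n (𝟙 (Z w)) _)))) (Σ-*ˡ n q _))))))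
           (Σ-*ˡ n q _)))) ⟩
    sumFin n (λ x → card (λ w → X x ∧ (Z w ∧ A x w)))
      + ((t * sumFin n (λ y → card (sees y)) + q * sumFin n (λ w → 𝟙 (Z w) * card (heavy w))) + q * card T)
      ≤⟨ +-mono-≤ a (+-mono-≤ (+-mono-≤ (*-monoʳ-≤ t b)
           (*-monoʳ-≤ q (≤-trans (Σ-mono n (λ w → *-monoʳ-≤ (𝟙 (Z w)) (heavy-few w))) (≤-reflexive (Σ-*ʳ n _ _)))))
           (*-monoˡ-≤ (card T) q≤Q)) ⟩
    (C₁ * D * card Z + π * card X) + ((t * (C₁ * D * card Z + π * card T) + q * (card Z * (q ^ s * h))) + Q * card T)
      ≤⟨ +-monoʳ-≤ (C₁ * D * card Z + π * card X) (+-mono-≤ (+-mono-≤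
           (*-monoʳ-≤ t (+-monoʳ-≤ (C₁ * D * card Z) (*-monoʳ-≤ π T≤X)))
           (*-monoʳ-≤ q (*-monoʳ-≤ (card Z) (*-monoˡ-≤ h (^-monoʳ-≤ q s≤2s′))))) (*-monoʳ-≤ Q T≤X)) ⟩
    (C₁ * D * card Z + π * card X) + ((t * (C₁ * D * card Z + π * card X) + q * (card Z * (Q * h))) + Q * card X)
      ≡⟨ lem₁ C₁ t h q Q (card Z) (card X) ⟩
    ((C₁ + t * C₁) * Q + Q * h) * (q * card Z) + ((4 * t + t * (4 * t)) * Q + Q) * card X
      ≤⟨ +-monoˡ-≤ _ (*-monoʳ-≤ ((C₁ + t * C₁) * Q + Q * h) qZ≤X) ⟩
    ((C₁ + t * C₁) * Q + Q * h) * card X + ((4 * t + t * (4 * t)) * Q + Q) * card X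
      ≡⟨ lem₂ C₁ t h Q (card X) ⟩
    L₀ * Q * card X ∎)
    where
    open ≤-Reasoning
    T≤X : card T ≤ card X
    T≤X = ≤-trans (card-mono (λ y e → proj₁ (∧-elim {not (X y)} e))) Y≤X
    -- Here `s ≥ 2` enters: it makes both `q` and `q ^ s` at most `Q`.
    s≤2s′ : s ≤ 2 * s′
    s≤2s′ = +-mono-≤ (>-nonZero⁻¹ s′) (≤-reflexive (sym (+-identityʳ s′)))
    q≤Q : q ≤ Q
    q≤Q = ≤-trans (≤-reflexive (sym (^-identityʳ q))) (^-monoʳ-≤ q (≤-trans (s≤s z≤n) s≤2s′))
    lem₁ : ∀ c t h q Q z x →
      (c * (q * Q) * z + 4 * t * Q * x) + ((t * (c * (q * Q) * z + 4 * t * Q * x) + q * (z * (Q * h))) + Q * x)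
      ≡ ((c + t * c) * Q + Q * h) * (q * z) + ((4 * t + t * (4 * t)) * Q + Q) * x
    lem₁ = solve-∀
    lem₂ : ∀ c t h Q x → ((c + t * c) * Q + Q * h) * x + ((4 * t + t * (4 * t)) * Q + Q) * x
      ≡ ((c + 4 * t) + t * (c + 4 * t) + h + 1) * Q * x
    lem₂ = solve-∀

-- Average degrees as rationals

-- Since `_/_` normalises, cross-multiplication is carried out on unnormalised rationals.
fraction-≤ : ∀ a b c d .{{_ : NonZero b}} .{{_ : NonZero d}} → a * d ≤ c * b → (ℤ.+ a) ℚ./ b ≤ℚ (ℤ.+ c) ℚ./ d
fraction-≤ a (suc b) c (suc d) le = ℚ.toℚᵘ-cancel-≤ (begin
  toℚᵘ (fromℚᵘ (mkℚᵘ (ℤ.+ a) b)) ≃⟨ ℚ.toℚᵘ-fromℚᵘ (mkℚᵘ (ℤ.+ a) b) ⟩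
  mkℚᵘ (ℤ.+ a) b ≤⟨ *≤* (subst₂ ℤ._≤_ (ℤ.pos-* a (suc d)) (ℤ.pos-* c (suc b)) (ℤ.+≤+ le)) ⟩
  mkℚᵘ (ℤ.+ c) d ≃⟨ ℚ.toℚᵘ-fromℚᵘ (mkℚᵘ (ℤ.+ c) d) ⟨
  toℚᵘ (fromℚᵘ (mkℚᵘ (ℤ.+ c) d)) ∎)
  where open ℚᵘ.≤-Reasoning

fromℚᵘ-homo-* : ∀ p q → fromℚᵘ p *ℚ fromℚᵘ q ≡ fromℚᵘ (p ℚᵘ.* q)
fromℚᵘ-homo-* p q = ℚ.toℚᵘ-injective (begin
  toℚᵘ (fromℚᵘ p *ℚ fromℚᵘ q) ≈⟨ ℚ.toℚᵘ-homo-* (fromℚᵘ p) (fromℚᵘ q) ⟩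
  toℚᵘ (fromℚᵘ p) ℚᵘ.* toℚᵘ (fromℚᵘ q) ≈⟨ ℚᵘ.*-cong (ℚ.toℚᵘ-fromℚᵘ p) (ℚ.toℚᵘ-fromℚᵘ q) ⟩
  p ℚᵘ.* q ≈⟨ ℚ.toℚᵘ-fromℚᵘ (p ℚᵘ.* q) ⟨
  toℚᵘ (fromℚᵘ (p ℚᵘ.* q)) ∎)
  where open import Relation.Binary.Reasoning.Setoid ℚᵘ.≃-setoid

natℚ : ℕ → ℚ
natℚ k = (ℤ.+ k) ℚ./ 1

natℚ-mono : ∀ {a b} → a ≤ b → natℚ a ≤ℚ natℚ b
natℚ-mono {a} {b} le = fraction-≤ a 1 b 1 (*-monoˡ-≤ 1 le)

natℚ-* : ∀ a b → natℚ (a * b) ≡ natℚ a *ℚ natℚ b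
natℚ-* a b = trans (cong (ℚ._/ 1) (ℤ.pos-* a b)) (sym (fromℚᵘ-homo-* (mkℚᵘ (ℤ.+ a) 0) (mkℚᵘ (ℤ.+ b) 0)))

natℚ-^ : ∀ a k → natℚ (a ^ k) ≡ natℚ a ^ℚ k
natℚ-^ a zero    = refl
natℚ-^ a (suc k) = trans (natℚ-* a (a ^ k)) (cong (natℚ a *ℚ_) (natℚ-^ a k))

reciprocal-* : ∀ k .{{_ : NonZero k}} → ((ℤ.+ 1) ℚ./ k) *ℚ natℚ k ≡ 1ℚ
reciprocal-* (suc k) = trans (fromℚᵘ-homo-* (mkℚᵘ (ℤ.+ 1) k) (mkℚᵘ (ℤ.+ suc k) 0))
  (ℚ.fromℚᵘ-cong {mkℚᵘ (ℤ.+ 1) k ℚᵘ.* mkℚᵘ (ℤ.+ suc k) 0} {mkℚᵘ (ℤ.+ 1) 0} (*≡* (cong ℤ.+_ (lem k))))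
  where
  lem : ∀ k → (1 + k + 0) * 1 ≡ 1 * ((1 + k) * 1)
  lem = solve-∀

fraction-nonNeg : ∀ a b .{{_ : NonZero b}} → NonNegative ((ℤ.+ a) ℚ./ b)
fraction-nonNeg a b = ℚ.normalize-nonNeg a b

^ℚ-nonNeg : ∀ p k .{{_ : NonNegative p}} → NonNegative (p ^ℚ k)
^ℚ-nonNeg p zero    = _
^ℚ-nonNeg p (suc k) = ℚ.nonNeg*nonNeg⇒nonNeg p (p ^ℚ k) {{^ℚ-nonNeg p k}}

^ℚ-mono : ∀ {p q} k .{{_ : NonNegative p}} .{{_ : NonNegative q}} → p ≤ℚ q → p ^ℚ k ≤ℚ q ^ℚ k
^ℚ-mono         zero    le = ℚ.≤-refl
^ℚ-mono {p} {q} (suc k) le = ℚ.≤-trans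
  (ℚ.*-monoˡ-≤-nonNeg p (^ℚ-mono k le)) (ℚ.*-monoʳ-≤-nonNeg (q ^ℚ k) {{^ℚ-nonNeg q k}} le)

^ℚ-inverse : ∀ {p q} k → p *ℚ q ≡ 1ℚ → (p ^ℚ k) *ℚ (q ^ℚ k) ≡ 1ℚ
^ℚ-inverse         zero    e = refl
^ℚ-inverse {p} {q} (suc k) e = begin
  (p *ℚ p ^ℚ k) *ℚ (q *ℚ q ^ℚ k) ≡⟨ ℚ.*-assoc p (p ^ℚ k) _ ⟩
  p *ℚ (p ^ℚ k *ℚ (q *ℚ q ^ℚ k)) ≡⟨ cong (p *ℚ_) (trans (sym (ℚ.*-assoc (p ^ℚ k) q _)) (trans (cong (_*ℚ q ^ℚ k) (ℚ.*-comm (p ^ℚ k) q)) (ℚ.*-assoc q (p ^ℚ k) _))) ⟩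
  p *ℚ (q *ℚ (p ^ℚ k *ℚ q ^ℚ k)) ≡⟨ cong (λ x → p *ℚ (q *ℚ x)) (^ℚ-inverse k e) ⟩
  p *ℚ (q *ℚ 1ℚ) ≡⟨ cong (p *ℚ_) (ℚ.*-identityʳ q) ⟩
  p *ℚ q ≡⟨ e ⟩
  1ℚ ∎
  where open ≡-Reasoning

reciprocal-power-≤ : ∀ C .{{_ : NonZero C}} k {y z} → y ≤ℚ (natℚ C ^ℚ k) *ℚ z → (((ℤ.+ 1) ℚ./ C) ^ℚ k) *ℚ y ≤ℚ z
reciprocal-power-≤ C k {y} {z} le = begin
  (c ^ℚ k) *ℚ y ≤⟨ ℚ.*-monoˡ-≤-nonNeg (c ^ℚ k) {{^ℚ-nonNeg c k {{fraction-nonNeg 1 C}}}} le ⟩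
  (c ^ℚ k) *ℚ ((natℚ C ^ℚ k) *ℚ z) ≡⟨ sym (ℚ.*-assoc (c ^ℚ k) (natℚ C ^ℚ k) z) ⟩
  ((c ^ℚ k) *ℚ (natℚ C ^ℚ k)) *ℚ z ≡⟨ cong (_*ℚ z) (^ℚ-inverse k (reciprocal-* C)) ⟩
  1ℚ *ℚ z ≡⟨ ℚ.*-identityˡ z ⟩
  z ∎
  where
  open ℚ.≤-Reasoning
  c = (ℤ.+ 1) ℚ./ C

-- The constant and the choice of `q`

identity-minor : ∀ G → MinorOf G G
identity-minor G = just , (λ u → u , refl) , (λ { u x y refl refl → here refl }) , (λ u u′ e → u , u′ , refl , refl , e)

-- The value of `L₀` as a function of `h` and `s′` alone, so that the final constant depends on
-- neither `G` nor `q`.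
minorConstant : ℕ → ℕ → ℕ
minorConstant h s′ = (C₁ + 4 * t) + t * (C₁ + 4 * t) + h + 1
  where
  t  = h + suc s′
  C₁ = 4 * t + 2 ^ t * 2 ^ t * h * suc s′

forced-minor : ∀ (G H : Graph) s′ .{{_ : NonZero s′}} → BipartiteBDeg≤ H (suc s′) → HFree H G →
  ∀ q .{{_ : NonZero q}} .{{_ : NonZero (order G)}} →
  4 * suc (minorConstant (order H) s′) * order G * q ^ (2 * s′) ≤ degSum G → DenseMinor G (q * q ^ (2 * s′))
forced-minor G H s′ bip free q dense with balanced-cut (adj G) (adj-sym G) (irrefl G)
... | X , big , Y≤X with CutBound.dense-minor-or-small-cut G H s′ bip free q X Y≤X
...   | inj₁ minor = minor
...   | inj₂ small = ⊥-elim (<-irrefl refl (begin-strict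
  -- The `suc` in the density threshold leaves `4 * (order G * Q)` to spare, which makes the
  -- contradiction strict.
  4 * (L * Q * order G) <⟨ m<m+n _ (>-nonZero⁻¹ (4 * (order G * Q)) {{m*n≢0 4 (order G * Q) {{_}} {{m*n≢0 (order G) Q}}}}) ⟩
  4 * (L * Q * order G) + 4 * (order G * Q) ≡⟨ lem L Q (order G) ⟩
  4 * suc L * order G * Q ≤⟨ dense ⟩
  degSum G ≡⟨ Σ-cong (order G) (λ v → count≡card (order G) (adj G v)) ⟩
  totalDegree (adj G) ≤⟨ big ⟩
  4 * cut (adj G) X ≤⟨ *-monoʳ-≤ 4 small ⟩
  4 * (L * Q * card X) ≤⟨ *-monoʳ-≤ 4 (*-monoʳ-≤ (L * Q) (card-≤ X)) ⟩
  4 * (L * Q * order G) ∎))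
  where
  open ≤-Reasoning
  L = minorConstant (order H) s′
  Q = q ^ (2 * s′)
  instance
    Q-nonZero : NonZero Q
    Q-nonZero = m^n≢0 q (2 * s′)
  lem : ∀ l q n → 4 * (l * q * n) + 4 * (n * q) ≡ 4 * (1 + l) * n * q
  lem = solve-∀

-- Upward search from `q = 1`. Fuel `S` suffices because `S < K * (S + 1) ^ e`.
largest-power-below : ∀ K e S .{{_ : NonZero K}} .{{_ : NonZero e}} → K ≤ S →
  ∃ λ q → NonZero q × K * q ^ e ≤ S × S < K * suc q ^ e
largest-power-below K e S K≤S = search S 1 (≤-trans (≤-reflexive (trans (cong (K *_) (^-zeroˡ e)) (*-identityʳ K))) K≤S)
    (begin-strict
      S <⟨ m<m+n S (s≤s z≤n) ⟩
      S + 1 ≤⟨ ≤-trans (≤-reflexive (sym (^-identityʳ (S + 1)))) (^-monoʳ-≤ (S + 1) {{>-nonZero (m≤n+m 1 S)}} (>-nonZero⁻¹ e)) ⟩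
      (S + 1) ^ e ≤⟨ m≤n*m _ K ⟩
      K * (S + 1) ^ e ∎)
  where
  open ≤-Reasoning
  search : ∀ fuel q .{{_ : NonZero q}} → K * q ^ e ≤ S → S < K * (fuel + q) ^ e →
    ∃ λ q → NonZero q × K * q ^ e ≤ S × S < K * suc q ^ e
  search zero       q lo hi = ⊥-elim (<⇒≱ hi lo)
  search (suc fuel) q lo hi with K * suc q ^ e ≤? S
  ... | yes lo′ = search fuel (suc q) lo′ (subst (λ x → S < K * x ^ e) (sym (+-suc fuel q)) hi)
  ... | no ≰ = q , >-nonZero (>-nonZero⁻¹ q) , lo , ≰⇒> ≰

module _ (e R C : ℕ) .{{_ : NonZero R}} .{{_ : NonZero C}} (R^≤C^ : R ^ suc e ≤ C ^ e) where

  bounded-average : ∀ S n .{{_ : NonZero n}} → S ≤ R * n →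
    (((ℤ.+ 1) ℚ./ C) ^ℚ e) *ℚ (((ℤ.+ S) ℚ./ n) ^ℚ suc e) ≤ℚ ((ℤ.+ S) ℚ./ n) ^ℚ e
  bounded-average S n le = reciprocal-power-≤ C e (ℚ.*-monoʳ-≤-nonNeg (r ^ℚ e) {{^ℚ-nonNeg r e {{fraction-nonNeg S n}}}} (begin
    r ≤⟨ fraction-≤ S n R 1 (≤-trans (≤-reflexive (*-identityʳ S)) le) ⟩
    natℚ R ≤⟨ natℚ-mono (≤-trans (m≤m*n R (R ^ e) {{m^n≢0 R e}}) R^≤C^) ⟩
    natℚ (C ^ e) ≡⟨ natℚ-^ C e ⟩
    natℚ C ^ℚ e ∎))
    where
    open ℚ.≤-Reasoning
    r = (ℤ.+ S) ℚ./ n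

  -- With `Q = q ^ e` one has `Q ^ suc e = (q * Q) ^ e`, so the powers of `q` on the two sides agree
  -- and only `R ^ suc e ≤ C ^ e` remains.
  improved-average : ∀ q S n S′ n′ .{{_ : NonZero n}} .{{_ : NonZero n′}} → S ≤ R * q ^ e * n → q * q ^ e * n′ ≤ S′ →
    (((ℤ.+ 1) ℚ./ C) ^ℚ e) *ℚ (((ℤ.+ S) ℚ./ n) ^ℚ suc e) ≤ℚ ((ℤ.+ S′) ℚ./ n′) ^ℚ e
  improved-average q S n S′ n′ le le′ = reciprocal-power-≤ C e (begin
    ((ℤ.+ S) ℚ./ n) ^ℚ suc e ≤⟨ ^ℚ-mono (suc e) {{fraction-nonNeg S n}} {{fraction-nonNeg (R * Q) 1}}
      (fraction-≤ S n (R * Q) 1 (≤-trans (≤-reflexive (*-identityʳ S)) le)) ⟩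
    natℚ (R * Q) ^ℚ suc e ≡⟨ sym (natℚ-^ (R * Q) (suc e)) ⟩
    natℚ ((R * Q) ^ suc e) ≤⟨ natℚ-mono powers ⟩
    natℚ (C ^ e * (q * Q) ^ e) ≡⟨ trans (natℚ-* (C ^ e) _) (cong₂ _*ℚ_ (natℚ-^ C e) (natℚ-^ (q * Q) e)) ⟩
    (natℚ C ^ℚ e) *ℚ (natℚ (q * Q) ^ℚ e)
      ≤⟨ ℚ.*-monoˡ-≤-nonNeg (natℚ C ^ℚ e) {{^ℚ-nonNeg (natℚ C) e {{fraction-nonNeg C 1}}}}
           (^ℚ-mono e {{fraction-nonNeg (q * Q) 1}} {{fraction-nonNeg S′ n′}}
             (fraction-≤ (q * Q) 1 S′ n′ (≤-trans le′ (≤-reflexive (sym (*-identityʳ S′)))))) ⟩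
    (natℚ C ^ℚ e) *ℚ (((ℤ.+ S′) ℚ./ n′) ^ℚ e) ∎)
    where
    open ℚ.≤-Reasoning
    Q = q ^ e
    powers : (R * Q) ^ suc e ≤ C ^ e * (q * Q) ^ e
    powers = ≤-trans (≤-reflexive (^-distribʳ-* (suc e) R Q))
      (*-mono-≤ R^≤C^ (≤-reflexive (sym (^-distribʳ-* e q Q))))

-- The `e`-th power of "average degree at least `c r^(k/e)`", which keeps the statement rational.
MinorOfAverage : (G : Graph) .{{_ : NonZero (order G)}} → ℚ → ℕ → ℕ → Set
MinorOfAverage G c e k = Σ Graph λ Γ → Σ (NonZero (order Γ)) λ nz → MinorOf Γ G ×
  ((c ^ℚ e) *ℚ (avgDeg G ^ℚ k) ≤ℚ (avgDeg Γ {{nz}} ^ℚ e))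

module _ (e K : ℕ) .{{_ : NonZero e}} .{{_ : NonZero K}} where

  private
    -- For maximal `q` the average degree is below `K * suc q ^ e`, and `suc q ≤ 2 * q` turns this
    -- into `R * q ^ e`.
    R = K * 2 ^ e
    -- Since `e ≥ 1`, `R ^ suc e ≤ R ^ (e + e) = C ^ e`.
    C = R * R
    instance
      2^e-nonZero : NonZero (2 ^ e)
      2^e-nonZero = m^n≢0 2 e
      R-nonZero : NonZero R
      R-nonZero = m*n≢0 K (2 ^ e)
      C-nonZero : NonZero C
      C-nonZero = m*n≢0 R R

    R^≤C^ : R ^ suc e ≤ C ^ e
    R^≤C^ = ≤-trans (^-monoʳ-≤ R (+-monoˡ-≤ e (>-nonZero⁻¹ e)))
      (≤-reflexive (trans (^-distribˡ-+-* R e e) (sym (^-distribʳ-* e R R))))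

  averageConstant : ℚ
  averageConstant = (ℤ.+ 1) ℚ./ C

  averageConstant-pos : 0ℚ <ℚ averageConstant
  averageConstant-pos = ℚ.positive⁻¹ averageConstant {{ℚ.normalize-pos 1 C}}

  -- Below average degree `K` the graph itself serves as the minor. Otherwise the largest `q`
  -- permitted by the density threshold is used.
  minor-of-large-average : (G : Graph) .{{_ : NonZero (order G)}} →
    (∀ q .{{_ : NonZero q}} → K * order G * q ^ e ≤ degSum G → DenseMinor G (q * q ^ e)) →
    MinorOfAverage G averageConstant e (suc e)
  minor-of-large-average G {{G-nonempty}} forced with K * order G ≤? degSum G
  ... | no ≰ = G , >-nonZero (>-nonZero⁻¹ (order G)) , identity-minor G ,
    bounded-average e R C R^≤C^ (degSum G) (order G) (≤-trans (<⇒≤ (≰⇒> ≰)) (*-monoˡ-≤ (order G) (m≤m*n K (2 ^ e))))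
  ... | yes dense =
    let (q , q≢0 , lo , hi) = largest-power-below (K * order G) e (degSum G) {{m*n≢0 K (order G)}} dense
        (Γ , nz , isMinor , denseΓ) = forced q {{q≢0}} lo
        suc≤double = +-mono-≤ (>-nonZero⁻¹ q {{q≢0}}) (≤-reflexive (sym (+-identityʳ q)))
        le = ≤-trans (<⇒≤ hi) (≤-trans
          (*-monoʳ-≤ (K * order G) (≤-trans (^-monoˡ-≤ e suc≤double) (≤-reflexive (^-distribʳ-* e 2 q))))
          (≤-reflexive (lem K (order G) (2 ^ e) (q ^ e))))
    in Γ , nz , isMinor ,
       improved-average e R C R^≤C^ q (degSum G) (order G) (degSum Γ) (order Γ) {{G-nonempty}} {{nz}} le denseΓ
    where
    lem : ∀ k n a b → k * n * (a * b) ≡ k * a * b * n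
    lem = solve-∀

theorem4p6 : (H : Graph) (s : ℕ) → 2 ≤ s → BipartiteBDeg≤ H s →
    Σ ℚ λ c → (0ℚ <ℚ c) ×
    ((G : Graph) → .{{_ : NonZero (order G)}} → HFree H G →
    Σ Graph λ Γ → Σ (NonZero (order Γ)) λ nz → MinorOf Γ G ×
    ((c ^ℚ (2 * (s ∸ 1))) *ℚ (avgDeg G ^ℚ (2 * s ∸ 1))
    ≤ℚ (avgDeg Γ {{nz}} ^ℚ (2 * (s ∸ 1)))))
theorem4p6 H (suc s′) (s≤s 1≤s′) bip = averageConstant e K , averageConstant-pos e K , λ G free →
  -- The exponent `2 * s ∸ 1` computes to `s′ + suc (s′ + 0)`, which has to be rewritten as `suc e`.
  subst (MinorOfAverage G (averageConstant e K) e) (sym (+-suc s′ (s′ + 0)))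
    (minor-of-large-average e K G (λ q → forced-minor G H s′ bip free q))
  where
  e = 2 * s′
  K = 4 * suc (minorConstant (order H) s′)
  instance
    s′-nonZero : NonZero s′
    s′-nonZero = >-nonZero 1≤s′
    e-nonZero : NonZero e
    e-nonZero = m*n≢0 2 s′
    K-nonZero : NonZero K
    K-nonZero = m*n≢0 4 (suc (minorConstant (order H) s′))
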